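{- Let $r\ge 3$ and $k\ge 3$ be integers and let $G$ be a $\mathcal{G}_k^{(r)}$-free $r$-graph. Let $F\in\mathcal{M}_2$ be the union of the 1-clusters $T_1,\dots,T_m\in\mathcal{M}_1$ contained in it, and write $e_i=|T_i|$ (so $(e_1,\dots,e_m)$ is a composition of $F$). Then $$|P_1(F)|=\sum_{i=1}^m\left(e_i\binom{r}{2}-e_i+1\right)\quad\text{and}\quad |P_{\overline{1}2}(F)|\ge 1-m+\sum_{i=1}^m (e_i-1)(r-2)^2.$$
   Context: An $r$-graph is identified with its edge set; $|H|$ is its number of edges and $V(H)=\bigcup_{e\in H}e$. The family $\mathcal{G}_k^{(r)}$ consists of all $r$-graphs $H$ such that either $|H|=k$ and $|V(H)|\le (r-2)k+2$, or $|H|=\ell$ and $|V(H)|\le (r-2)\ell+1$ for some $\ell\in\{2,\dots,k-1\}$; $G$ is $\mathcal{G}_k^{(r)}$-free if no subset of its edges forms a member of this family. For $F\subseteq G$ and distinct vertices $x,y$, let $C_F(xy)$ be the set of integers $i\ge 0$ for which there exist $i$ distinct edges $e_1,\dots,e_i\in F$ with $|\{x,y\}\cup e_1\cup\dots\cup e_i|\le (r-2)i+2$. Let $P_1(F)$ be the set of pairs $xy\in\binom{V(F)}{2}$ with $1\in C_F(xy)$, and $P_{\overline{1}2}(F)$ the set of pairs $xy\in\binom{V(F)}{2}$ with $2\in C_F(xy)$ and $1\notin C_F(xy)$. An $r$-graph is connected if for any edges $X,Y$ of it there are edges $X=X_1,\dots,X_m=Y$ with $|X_i\cap X_{i+1}|\ge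 2$ for all $i$. $\mathcal{M}_1$ is the partition of $E(G)$ into maximal connected subgraphs (1-clusters). Edge-disjoint $F,H\subseteq G$ are $1|2$-mergeable if there is a pair $xy$ with $1\in C_F(xy)$ and $2\in C_H(xy)$, or $2\in C_F(xy)$ and $1\in C_H(xy)$. $\mathcal{M}_2$ is a partition of $E(G)$ obtained from $\mathcal{M}_1$ by repeatedly replacing two distinct $1|2$-mergeable parts by their union as long as possible; each part of $\mathcal{M}_2$ is a union of elements of $\mathcal{M}_1$. -}

module Defs where

open import Data.Nat using (ℕ; _+_; _*_; _∸_; _≤_; _<_; _≟_; _≤?_; _<?_)
open import Data.Fin using (Fin; toℕ)
open import Data.Fin.Subset using (Subset; _∈_; _⊆_; _∪_; _∩_; ⁅_⁆; ⋃; ∣_∣; Nonempty)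
open import Data.Fin.Subset.Properties using (_∈?_; _⊆?_; anySubset?)
open import Data.List using (List; []; _∷_; map; filter; length; concatMap; allFin)
open import Data.List.Relation.Binary.Permutation.Propositional using (_↭_)
open import Data.Product using (Σ; ∃; _×_; _,_)
open import Data.Sum using (_⊎_)
open import Relation.Nullary using (¬_; Dec)
open import Relation.Nullary.Decidable using (_×-dec_; ¬?)
open import Relation.Binary.PropositionalEquality using (_≡_; _≢_)

-- Setting: an r-graph G on vertex set Fin n with m edges, given by an
-- injective edge map E : Fin m → Subset n with every edge of size r.
-- Sub-(edge)-sets of G (F, H, T, ...) are subsets S : Subset m of edge indices.

IsRGraph : (r : ℕ) {m n : ℕ} → (Fin m → Subset n) → Set
IsRGraph r {m} E = (∀ i → ∣ E i ∣ ≡ r) × (∀ i j → E i ≡ E j → i ≡ j)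

V : {m n : ℕ} → (Fin m → Subset n) → Subset m → Subset n
V {m} E S = ⋃ (map E (filter (λ i → i ∈? S) (allFin m)))

GkFree : (r k : ℕ) {m n : ℕ} → (Fin m → Subset n) → Set
GkFree r k {m} E =
  (∀ (S : Subset m) → ∣ S ∣ ≡ k → ¬ (∣ V E S ∣ ≤ (r ∸ 2) * k + 2)) ×
  (∀ (S : Subset m) → 2 ≤ ∣ S ∣ → ∣ S ∣ ≤ k ∸ 1 → ¬ (∣ V E S ∣ ≤ (r ∸ 2) * ∣ S ∣ + 1))

InC : (r : ℕ) {m n : ℕ} → (Fin m → Subset n) → Subset m → Fin n → Fin n → ℕ → Set
InC r {m} E F x y i =
  ∃ λ (S : Subset m) → S ⊆ F × ∣ S ∣ ≡ i × ∣ (⁅ x ⁆ ∪ ⁅ y ⁆) ∪ V E S ∣ ≤ (r ∸ 2) * i + 2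

InC? : (r : ℕ) {m n : ℕ} (E : Fin m → Subset n) (F : Subset m) (x y : Fin n) (i : ℕ) →
       Dec (InC r E F x y i)
InC? r E F x y i =
  anySubset? (λ S → (S ⊆? F) ×-dec ((∣ S ∣ ≟ i) ×-dec (∣ (⁅ x ⁆ ∪ ⁅ y ⁆) ∪ V E S ∣ ≤? (r ∸ 2) * i + 2)))

-- unordered pairs {x,y} ⊆ V(F), represented as (x , y) with x < y
PairIn : {m n : ℕ} → (Fin m → Subset n) → Subset m → Fin n × Fin n → Set
PairIn E F (x , y) = toℕ x < toℕ y × x ∈ V E F × y ∈ V E F

PairIn? : {m n : ℕ} (E : Fin m → Subset n) (F : Subset m) (p : Fin n × Fin n) → Dec (PairIn E F p)
PairIn? E F (x , y) = (toℕ x <? toℕ y) ×-dec ((x ∈? V E F) ×-dec (y ∈? V E F))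

allPairs : (n : ℕ) → List (Fin n × Fin n)
allPairs n = concatMap (λ x → map (x ,_) (allFin n)) (allFin n)

P1card : (r : ℕ) {m n : ℕ} → (Fin m → Subset n) → Subset m → ℕ
P1card r {n = n} E F =
  length (filter (λ { (x , y) → PairIn? E F (x , y) ×-dec InC? r E F x y 1 }) (allPairs n))

P12card : (r : ℕ) {m n : ℕ} → (Fin m → Subset n) → Subset m → ℕ
P12card r {n = n} E F =
  length (filter (λ { (x , y) → PairIn? E F (x , y) ×-dec (InC? r E F x y 2 ×-dec ¬? (InC? r E F x y 1)) })
                 (allPairs n))

data Chain {m n : ℕ} (E : Fin m → Subset n) (T : Subset m) : Fin m → Fin m → Set where
  here : ∀ {X} → X ∈ T → Chain E T X X
  step : ∀ {X Z Y} → X ∈ T → 2 ≤ ∣ E X ∩ E Z ∣ → Chain E T Z Y → Chain E T X Y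

Connected : {m n : ℕ} → (Fin m → Subset n) → Subset m → Set
Connected E T = ∀ X Y → X ∈ T → Y ∈ T → Chain E T X Y

OneCluster : {m n : ℕ} → (Fin m → Subset n) → Subset m → Set
OneCluster {m} E T = Nonempty T × Connected E T × (∀ (T' : Subset m) → Connected E T' → T ⊆ T' → T' ⊆ T)

IsM1 : {m n : ℕ} → (Fin m → Subset n) → List (Subset m) → Set
IsM1 {m} E L = Unique L × (∀ (T : Subset m) → (T ∈L L → OneCluster E T) × (OneCluster E T → T ∈L L))
  where
  open import Data.List.Relation.Unary.Unique.Propositional using (Unique)
  open import Data.List.Membership.Propositional renaming (_∈_ to _∈L_)

Mergeable : (r : ℕ) {m n : ℕ} → (Fin m → Subset n) → Subset m → Subset m → Set
Mergeable r {n = n} E F H = Σ (Fin n) λ x → Σ (Fin n) λ y → x ≢ y ×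
  ((InC r E F x y 1 × InC r E H x y 2) ⊎ (InC r E F x y 2 × InC r E H x y 1))

MergeStep : (r : ℕ) {m n : ℕ} → (Fin m → Subset n) → List (Subset m) → List (Subset m) → Set
MergeStep r {m} E L L' = Σ (Subset m) λ A → Σ (Subset m) λ B → Σ (List (Subset m)) λ rest →
  (L ↭ A ∷ B ∷ rest) × Mergeable r E A B × L' ≡ (A ∪ B) ∷ rest

data Merges (r : ℕ) {m n : ℕ} (E : Fin m → Subset n) : List (Subset m) → List (Subset m) → Set where
  done : ∀ {L} → Merges r E L L
  more : ∀ {L L' L''} → MergeStep r E L L' → Merges r E L' L'' → Merges r E L L''

Terminal : (r : ℕ) {m n : ℕ} → (Fin m → Subset n) → List (Subset m) → Set
Terminal r {m} E L = ∀ (A B : Subset m) (rest : List (Subset m)) → L ↭ A ∷ B ∷ rest → ¬ Mergeable r E A B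

IsM2 : (r : ℕ) {m n : ℕ} → (Fin m → Subset n) → List (Subset m) → Set
IsM2 r {m} E L = Σ (List (Subset m)) λ L₁ → IsM1 E L₁ × Merges r E L₁ L × Terminal r E L

{-# OPTIONS --safe #-}
module Submission where

-- Write r = 2 + d and forbid the size k + 1. A set S of edges is tight if it spans at most d|S| + 2 vertices. The union
-- of disjoint tight sets sharing two vertices is tight, and if they share three it spans at most d|S| + 1 vertices, which
-- is forbidden for 2 ≤ |S| ≤ k + 1. A cluster, built edge by edge, therefore meets every new edge in exactly one
-- pair, lying in an earlier edge; this gives its two counts.
--
-- For a merge of A and B along a pair xy of an edge X of A and two edges e of B, no other pair can be lost. Growing B
-- from e by tight pieces of at most two edges never reaches size k + 1, neither with nor without X added, so no size
-- can be skipped and |B| ≤ k - 1. If another pair shared with B were spanned by a tight piece w of A, then B ∪ w could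
-- be grown inside A, by the same argument up to size k + 1, until it covers xy; at that moment the part in A shares
-- three vertices with B, which is forbidden. So each merge loses at most one pair, whence the term 1 - m.

open import Defs
open import Data.Nat using (ℕ; zero; suc; _≤_; _<_; _*_; _∸_; _+_; _^_; z≤n; s≤s)
open import Data.Nat.Properties
open import Data.Nat.Solver using (module +-*-Solver)
open import Data.Nat.Combinatorics using (_C_; nC1≡n; nCk+nC[k+1]≡[n+1]C[k+1])
open import Data.Fin using (Fin; zero; suc; toℕ)
open import Data.Fin.Properties using (toℕ-injective) renaming (_≟_ to _≟ᶠ_)
open import Data.Fin.Subset using (Subset; inside; outside; _∈_; _∉_; _⊆_; _∪_; _∩_; ∁; ⁅_⁆; ⋃; ∣_∣; Nonempty)
  renaming (⊥ to ∅)
open import Data.Fin.Subset.Properties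
open import Data.Vec using ([]; _∷_; here; there)
open import Data.Bool using (if_then_else_)
open import Data.List using (List; []; _∷_; map; length; filter; concat; allFin; tabulate) renaming (_++_ to _++ᴸ_)
open import Data.Nat.ListAction using (sum)
open import Data.Nat.ListAction.Properties using (sum-++; sum-↭)
import Data.List.Properties as List
open import Data.List.Relation.Unary.All as All using (All; []; _∷_)
open import Data.List.Relation.Unary.AllPairs using (AllPairs; []; _∷_)
open import Data.List.Relation.Unary.Unique.Propositional using (Unique)
open import Data.List.Relation.Unary.Unique.Propositional.Properties using () renaming (++⁺ to Unique-++⁺)
open import Data.List.Membership.Propositional.Properties.WithK using (unique∧set⇒bag)
open import Data.List.Relation.Binary.BagAndSetEquality using (∼bag⇒↭)
open import Data.List.Relation.Binary.Permutation.Propositional using (_↭_; ↭⇒↭ₛ)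
open import Data.List.Relation.Binary.Permutation.Propositional.Properties using (All-resp-↭; ↭-length) renaming (map⁺ to ↭-map⁺)
open import Data.List.Relation.Binary.Permutation.Setoid.Properties using (AllPairs-resp-↭)
open import Data.List.Membership.Propositional.Properties using (∈-filter⁺; ∈-filter⁻; ∈-map⁺; ∈-map⁻; ∈-allFin; ∈-++⁻; ∈-++⁺ˡ; ∈-++⁺ʳ)
open import Data.List.Membership.Propositional using () renaming (_∈_ to _∈ᴸ_)
open import Data.List.Relation.Unary.Any using (here; there)
open import Data.Product using (∃; _×_; _,_; proj₁; proj₂)
open import Data.Sum using (_⊎_; inj₁; inj₂; [_,_]′) renaming (map to ⊎-map)
open import Data.Empty using (⊥; ⊥-elim)
open import Function using (_∘_; id; _$_; mk⇔)
open import Relation.Nullary using (¬_; Dec; yes; no; does; contradiction)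
open import Relation.Nullary.Decidable using (_×-dec_; _⊎-dec_; ¬?)
open import Relation.Binary.PropositionalEquality
open import Algebra.Properties.Semiring.Sum +-*-semiring
  using (∑-distrib-+; ∑-comm; sum-cong-≗; *-distribˡ-sum; *-distribʳ-sum; sum-replicate-zero) renaming (sum to ∑)

private
  variable
    n m : ℕ

-- Cardinalities of finite subsets, and induction by enlarging a subset.

Disjoint : Subset n → Subset n → Set
Disjoint p q = ∀ {x} → x ∈ p → x ∈ q → ⊥

∣p∪q∣+∣p∩q∣≡∣p∣+∣q∣ : (p q : Subset n) → ∣ p ∪ q ∣ + ∣ p ∩ q ∣ ≡ ∣ p ∣ + ∣ q ∣
∣p∪q∣+∣p∩q∣≡∣p∣+∣q∣ [] [] = refl
∣p∪q∣+∣p∩q∣≡∣p∣+∣q∣ (outside ∷ p) (outside ∷ q) = ∣p∪q∣+∣p∩q∣≡∣p∣+∣q∣ p q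
∣p∪q∣+∣p∩q∣≡∣p∣+∣q∣ (inside ∷ p) (outside ∷ q) = cong suc (∣p∪q∣+∣p∩q∣≡∣p∣+∣q∣ p q)
∣p∪q∣+∣p∩q∣≡∣p∣+∣q∣ (outside ∷ p) (inside ∷ q) =
  trans (cong suc (∣p∪q∣+∣p∩q∣≡∣p∣+∣q∣ p q)) (sym (+-suc _ _))
∣p∪q∣+∣p∩q∣≡∣p∣+∣q∣ (inside ∷ p) (inside ∷ q) =
  cong suc (trans (+-suc _ _) (trans (cong suc (∣p∪q∣+∣p∩q∣≡∣p∣+∣q∣ p q)) (sym (+-suc _ _))))

∣p∩q∣+∣p∩∁q∣≡∣p∣ : (p q : Subset n) → ∣ p ∩ q ∣ + ∣ p ∩ ∁ q ∣ ≡ ∣ p ∣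
∣p∩q∣+∣p∩∁q∣≡∣p∣ [] [] = refl
∣p∩q∣+∣p∩∁q∣≡∣p∣ (outside ∷ p) (outside ∷ q) = ∣p∩q∣+∣p∩∁q∣≡∣p∣ p q
∣p∩q∣+∣p∩∁q∣≡∣p∣ (outside ∷ p) (inside ∷ q) = ∣p∩q∣+∣p∩∁q∣≡∣p∣ p q
∣p∩q∣+∣p∩∁q∣≡∣p∣ (inside ∷ p) (inside ∷ q) = cong suc (∣p∩q∣+∣p∩∁q∣≡∣p∣ p q)
∣p∩q∣+∣p∩∁q∣≡∣p∣ (inside ∷ p) (outside ∷ q) = trans (+-suc _ _) (cong suc (∣p∩q∣+∣p∩∁q∣≡∣p∣ p q))

∣p∪q∣-disjoint : (p q : Subset n) → Disjoint p q → ∣ p ∪ q ∣ ≡ ∣ p ∣ + ∣ q ∣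
∣p∪q∣-disjoint {n} p q dj = begin
  ∣ p ∪ q ∣              ≡⟨ +-identityʳ _ ⟨
  ∣ p ∪ q ∣ + 0          ≡⟨ cong (∣ p ∪ q ∣ +_) (trans (cong ∣_∣ (Empty-unique empty)) (∣⊥∣≡0 n)) ⟨
  ∣ p ∪ q ∣ + ∣ p ∩ q ∣  ≡⟨ ∣p∪q∣+∣p∩q∣≡∣p∣+∣q∣ p q ⟩
  ∣ p ∣ + ∣ q ∣          ∎
  where
  open ≡-Reasoning
  empty : ¬ Nonempty (p ∩ q)
  empty (x , x∈) = dj (proj₁ (x∈p∩q⁻ p q x∈)) (proj₂ (x∈p∩q⁻ p q x∈))

p⊆q∧∣q∣≤∣p∣⇒q⊆p : {p q : Subset n} → p ⊆ q → ∣ q ∣ ≤ ∣ p ∣ → q ⊆ p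
p⊆q∧∣q∣≤∣p∣⇒q⊆p {p = p} p⊆q q≤p {x} x∈q with x ∈? p
... | yes x∈p = x∈p
... | no  x∉p = contradiction (p⊂q⇒∣p∣<∣q∣ (p⊆q , x , x∈q , x∉p)) (≤⇒≯ q≤p)

x≢y⇒∣⁅x⁆∪⁅y⁆∣≡2 : {x y : Fin n} → x ≢ y → ∣ ⁅ x ⁆ ∪ ⁅ y ⁆ ∣ ≡ 2
x≢y⇒∣⁅x⁆∪⁅y⁆∣≡2 {x = x} {y} x≢y = trans
  (∣p∪q∣-disjoint ⁅ x ⁆ ⁅ y ⁆ λ z∈x z∈y → x≢y (trans (sym (x∈⁅y⁆⇒x≡y x z∈x)) (x∈⁅y⁆⇒x≡y y z∈y)))
  (cong₂ _+_ (∣⁅x⁆∣≡1 x) (∣⁅x⁆∣≡1 y))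

∪-lub : {p q s : Subset n} → p ⊆ s → q ⊆ s → p ∪ q ⊆ s
∪-lub {p = p} {q} p⊆s q⊆s x∈ with x∈p∪q⁻ p q x∈
... | inj₁ x∈p = p⊆s x∈p
... | inj₂ x∈q = q⊆s x∈q

⁅x⁆⊆ : {x : Fin n} {p : Subset n} → x ∈ p → ⁅ x ⁆ ⊆ p
⁅x⁆⊆ {x = x} {p} x∈p z∈ = subst (_∈ p) (sym (x∈⁅y⁆⇒x≡y x z∈)) x∈p

⁅x⁆∪⁅y⁆⊆ : {x y : Fin n} {p : Subset n} → x ∈ p → y ∈ p → ⁅ x ⁆ ∪ ⁅ y ⁆ ⊆ p
⁅x⁆∪⁅y⁆⊆ x∈p y∈p = ∪-lub (⁅x⁆⊆ x∈p) (⁅x⁆⊆ y∈p)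

x≢y⇒2≤∣p∣ : {x y : Fin n} {p : Subset n} → x ≢ y → x ∈ p → y ∈ p → 2 ≤ ∣ p ∣
x≢y⇒2≤∣p∣ x≢y x∈p y∈p = subst (_≤ _) (x≢y⇒∣⁅x⁆∪⁅y⁆∣≡2 x≢y) (p⊆q⇒∣p∣≤∣q∣ (⁅x⁆∪⁅y⁆⊆ x∈p y∈p))

x∉yz⇒3≤∣p∣ : {x y z : Fin n} {p : Subset n} → y ≢ z → x ∉ ⁅ y ⁆ ∪ ⁅ z ⁆ → x ∈ p → y ∈ p → z ∈ p → 3 ≤ ∣ p ∣
x∉yz⇒3≤∣p∣ {x = x} y≢z x∉ x∈p y∈p z∈p =
  subst (_< _) (x≢y⇒∣⁅x⁆∪⁅y⁆∣≡2 y≢z) (p⊂q⇒∣p∣<∣q∣ (⁅x⁆∪⁅y⁆⊆ y∈p z∈p , x , x∈p , x∉))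

nonempty⇒1≤∣p∣ : {p : Subset n} → Nonempty p → 1 ≤ ∣ p ∣
nonempty⇒1≤∣p∣ (x , x∈p) = subst (_≤ _) (∣⁅x⁆∣≡1 x) (p⊆q⇒∣p∣≤∣q∣ (⁅x⁆⊆ x∈p))

1≤∣p∣⇒nonempty : {p : Subset n} → 1 ≤ ∣ p ∣ → Nonempty p
1≤∣p∣⇒nonempty {n} {p} 1≤ with nonempty? p
... | yes ne = ne
... | no  ¬ne = contradiction (subst (1 ≤_) (trans (cong ∣_∣ (Empty-unique ¬ne)) (∣⊥∣≡0 n)) 1≤) λ ()

∩-mono : {p q s t : Subset n} → p ⊆ s → q ⊆ t → p ∩ q ⊆ s ∩ t
∩-mono {p = p} {q} p⊆s q⊆t x∈ = x∈p∩q⁺ (p⊆s (proj₁ (x∈p∩q⁻ p q x∈)) , q⊆t (proj₂ (x∈p∩q⁻ p q x∈)))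

¬p⊆q⇒∃ : {p q : Subset n} → ¬ p ⊆ q → ∃ λ x → x ∈ p × x ∉ q
¬p⊆q⇒∃ {p = p} {q} p⊈q with nonempty? (p ∩ ∁ q)
... | yes (x , x∈) = x , proj₁ (x∈p∩q⁻ p _ x∈) , x∈∁p⇒x∉p (proj₂ (x∈p∩q⁻ p _ x∈))
... | no  empty    = contradiction (λ {x} x∈p → x∉∁p⇒x∈p λ x∈∁q → empty (x , x∈p∩q⁺ (x∈p , x∈∁q))) p⊈q

-- The common induction of the whole proof: every extension strictly raises the cardinality, which
-- is bounded by `∣ T ∣`, so `∣ T ∣` rounds of `fuel` suffice to reach `T`.
grow : {T : Subset m} (Inv : Subset m → Set) →
       (∀ {S} → S ⊆ T → ¬ T ⊆ S → Inv S → ∃ λ S′ → S′ ⊆ T × ∣ S ∣ < ∣ S′ ∣ × Inv S′) →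
       ∀ {S} → S ⊆ T → Inv S → Inv T
grow {T = T} Inv extend = go ∣ T ∣ (m≤m+n ∣ T ∣ _)
  where
  go : ∀ fuel {S} → ∣ T ∣ ≤ fuel + ∣ S ∣ → S ⊆ T → Inv S → Inv T
  go zero T≤S S⊆T inv = subst Inv (⊆-antisym S⊆T (p⊆q∧∣q∣≤∣p∣⇒q⊆p S⊆T T≤S)) inv
  go (suc fuel) {S} T≤ S⊆T inv with T ⊆? S
  ... | yes T⊆S = subst Inv (⊆-antisym S⊆T T⊆S) inv
  ... | no  T⊈S with S′ , S′⊆T , S<S′ , inv′ ← extend S⊆T T⊈S inv =
    go fuel (≤-trans T≤ (subst (_≤ fuel + ∣ S′ ∣) (+-suc fuel ∣ S ∣) (+-monoʳ-≤ fuel S<S′))) S′⊆T inv′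

-- Counting ordered pairs by sums of indicators

ind : {P : Set} → Dec P → ℕ
ind P? = if does P? then 1 else 0

module _ {P Q R S : Set} where
  ind-modular : (P? : Dec P) (Q? : Dec Q) (R? : Dec R) (S? : Dec S) →
    (P → R ⊎ S) → (Q → R ⊎ S) → (P → Q → R × S) → ind P? + ind Q? ≤ ind R? + ind S?
  ind-modular (no _)  (no _)  _ _ _ _ _ = z≤n
  ind-modular (no _)  (yes _) (yes _) _ _ _ _ = s≤s z≤n
  ind-modular (no _)  (yes _) (no _) (yes _) _ _ _ = s≤s z≤n
  ind-modular (no _)  (yes q) (no ¬r) (no ¬s) _ f _ = ⊥-elim ([ ¬r , ¬s ]′ (f q))
  ind-modular (yes _) (no _)  (yes _) _ _ _ _ = s≤s z≤n
  ind-modular (yes _) (no _)  (no _) (yes _) _ _ _ = s≤s z≤n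
  ind-modular (yes p) (no _)  (no ¬r) (no ¬s) f _ _ = ⊥-elim ([ ¬r , ¬s ]′ (f p))
  ind-modular (yes p) (yes q) (yes _) (yes _) _ _ _ = ≤-refl
  ind-modular (yes p) (yes q) (no ¬r) _ _ _ f = ⊥-elim (¬r (proj₁ (f p q)))
  ind-modular (yes p) (yes q) (yes _) (no ¬s) _ _ f = ⊥-elim (¬s (proj₂ (f p q)))

ind-cong : {P Q : Set} (P? : Dec P) (Q? : Dec Q) → (P → Q) → (Q → P) → ind P? ≡ ind Q?
ind-cong (yes _) (yes _) _ _ = refl
ind-cong (yes p) (no ¬q) f _ = ⊥-elim (¬q (f p))
ind-cong (no ¬p) (yes q) _ g = ⊥-elim (¬p (g q))
ind-cong (no _)  (no _)  _ _ = refl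

ind-no : {P : Set} (P? : Dec P) → ¬ P → ind P? ≡ 0
ind-no (yes p) ¬p = ⊥-elim (¬p p)
ind-no (no _)  _  = refl

∑-mono : {f g : Fin n → ℕ} → (∀ i → f i ≤ g i) → ∑ f ≤ ∑ g
∑-mono {zero}  f≤g = z≤n
∑-mono {suc n} f≤g = +-mono-≤ (f≤g zero) (∑-mono (f≤g ∘ suc))

∑-zero : {f : Fin n → ℕ} → (∀ i → f i ≡ 0) → ∑ f ≡ 0
∑-zero {n} f≡0 = trans (sum-cong-≗ f≡0) (sum-replicate-zero n)

∑∑-distrib-+ : (f g : Fin n → Fin n → ℕ) →
  ∑ (λ x → ∑ λ y → f x y + g x y) ≡ ∑ (λ x → ∑ (f x)) + ∑ (λ x → ∑ (g x))
∑∑-distrib-+ f g = trans (sum-cong-≗ λ x → ∑-distrib-+ (f x) (g x)) (∑-distrib-+ (∑ ∘ f) (∑ ∘ g))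

♯ : {P : Fin n → Fin n → Set} → (∀ x y → Dec (P x y)) → ℕ
♯ P? = ∑ λ x → ∑ λ y → ind (P? x y)

module _ {P Q R S : Fin n → Fin n → Set}
  (P? : ∀ x y → Dec (P x y)) (Q? : ∀ x y → Dec (Q x y))
  (R? : ∀ x y → Dec (R x y)) (S? : ∀ x y → Dec (S x y)) where
  -- Every comparison of pair counts is an instance. Two instances in opposite directions give
  -- inclusion-exclusion, and the empty relation `pairOf? ∅` fills the fourth place when only three
  -- counts are involved.
  ♯-modular : (∀ {x y} → P x y → R x y ⊎ S x y) → (∀ {x y} → Q x y → R x y ⊎ S x y) →
    (∀ {x y} → P x y → Q x y → R x y × S x y) → ♯ P? + ♯ Q? ≤ ♯ R? + ♯ S?
  ♯-modular f g h = begin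
    ♯ P? + ♯ Q?                               ≡⟨ ∑∑-distrib-+ (λ x y → ind (P? x y)) (λ x y → ind (Q? x y)) ⟨
    ∑ (λ x → ∑ λ y → ind (P? x y) + ind (Q? x y))
      ≤⟨ ∑-mono (λ x → ∑-mono λ y → ind-modular (P? x y) (Q? x y) (R? x y) (S? x y) f g h) ⟩
    ∑ (λ x → ∑ λ y → ind (R? x y) + ind (S? x y)) ≡⟨ ∑∑-distrib-+ (λ x y → ind (R? x y)) (λ x y → ind (S? x y)) ⟩
    ♯ R? + ♯ S?                               ∎
    where open ≤-Reasoning

length-filter-tabulate : {A : Set} {P : A → Set} (P? : ∀ a → Dec (P a)) (f : Fin n → A) →
  length (filter P? (tabulate f)) ≡ ∑ (λ i → ind (P? (f i)))
length-filter-tabulate {zero}  P? f = refl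
length-filter-tabulate {suc n} P? f with P? (f zero)
... | yes _ = cong suc (length-filter-tabulate P? (f ∘ suc))
... | no  _ = length-filter-tabulate P? (f ∘ suc)

length-filter-concat : {A : Set} {P : A → Set} (P? : ∀ a → Dec (P a)) (f : Fin n → List A) →
  length (filter P? (concat (tabulate f))) ≡ ∑ (λ i → length (filter P? (f i)))
length-filter-concat {zero}  P? f = refl
length-filter-concat {suc n} P? f =
  trans (cong length (List.filter-++ P? (f zero) (concat (tabulate (f ∘ suc)))))
 (trans (List.length-++ (filter P? (f zero)))
        (cong (length (filter P? (f zero)) +_) (length-filter-concat P? (f ∘ suc))))

-- Turns the list lengths in the definitions into double sums, which can be compared pointwise and
-- transposed.
length-filter-allPairs : {P : Fin n × Fin n → Set} (P? : ∀ p → Dec (P p)) →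
  length (filter P? (allPairs n)) ≡ ♯ (λ x y → P? (x , y))
length-filter-allPairs {n} P? = begin
  length (filter P? (concat (map row (allFin n)))) ≡⟨ cong (length ∘ filter P? ∘ concat) (List.map-tabulate id row) ⟩
  length (filter P? (concat (tabulate row)))       ≡⟨ length-filter-concat P? row ⟩
  ∑ (λ x → length (filter P? (row x)))
    ≡⟨ sum-cong-≗ (λ x → trans (cong (length ∘ filter P?) (List.map-tabulate id (x ,_)))
                               (length-filter-tabulate P? (x ,_))) ⟩
  ♯ (λ x y → P? (x , y)) ∎
  where
  open ≡-Reasoning
  row : Fin n → List (Fin n × Fin n)
  row x = map (x ,_) (allFin n)

∑-∈ : (W : Subset n) → ∑ (λ x → ind (x ∈? W)) ≡ ∣ W ∣
∑-∈ [] = refl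
∑-∈ (inside ∷ W) = cong suc (trans (sum-cong-≗ λ x → ind-cong (suc x ∈? (inside ∷ W)) (x ∈? W) drop-there there) (∑-∈ W))
∑-∈ (outside ∷ W) = trans (sum-cong-≗ λ x → ind-cong (suc x ∈? (outside ∷ W)) (x ∈? W) drop-there there) (∑-∈ W)

-- Numbers of pairs within one set and across two sets.

PairOf : Subset n → Fin n → Fin n → Set
PairOf W x y = toℕ x < toℕ y × x ∈ W × y ∈ W

pairOf? : (W : Subset n) (x y : Fin n) → Dec (PairOf W x y)
pairOf? W x y = (toℕ x <? toℕ y) ×-dec ((x ∈? W) ×-dec (y ∈? W))

-- Induction peels off vertex `zero`: it is never the larger element of a pair, and if it belongs to
-- the set it is the smaller one for exactly `∣ W ∣` pairs. Pascal's rule adds these to the pairs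
-- inside `W`.
♯-pairOf : (W : Subset n) → ♯ (pairOf? W) ≡ ∣ W ∣ C 2
♯-pairOf [] = refl
♯-pairOf (b ∷ W) = begin
  (0 + ∑ (λ y → ind (pairOf? (b ∷ W) zero (suc y))))
    + ∑ (λ x → ind (pairOf? (b ∷ W) (suc x) zero) + ∑ (λ y → ind (pairOf? (b ∷ W) (suc x) (suc y))))
    ≡⟨ cong (∑ (λ y → ind (pairOf? (b ∷ W) zero (suc y))) +_) (sum-cong-≗ λ x →
         cong₂ _+_ (ind-no (pairOf? (b ∷ W) (suc x) zero) λ ())
           (sum-cong-≗ λ y → ind-cong (pairOf? (b ∷ W) (suc x) (suc y)) (pairOf? W x y)
             (λ { (s≤s l , there p , there q) → l , p , q }) (λ { (l , p , q) → s≤s l , there p , there q }))) ⟩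
  ∑ (λ y → ind (pairOf? (b ∷ W) zero (suc y))) + ♯ (pairOf? W)
    ≡⟨ cong (∑ (λ y → ind (pairOf? (b ∷ W) zero (suc y))) +_) (♯-pairOf W) ⟩
  ∑ (λ y → ind (pairOf? (b ∷ W) zero (suc y))) + ∣ W ∣ C 2
    ≡⟨ first b ⟩
  ∣ b ∷ W ∣ C 2 ∎
  where
  open ≡-Reasoning
  first : ∀ b → ∑ (λ y → ind (pairOf? (b ∷ W) zero (suc y))) + ∣ W ∣ C 2 ≡ ∣ b ∷ W ∣ C 2
  first outside = cong (_+ ∣ W ∣ C 2) (∑-zero λ y → ind-no (pairOf? (outside ∷ W) zero (suc y)) λ { (_ , () , _) })
  first inside = begin
    ∑ (λ y → ind (pairOf? (inside ∷ W) zero (suc y))) + ∣ W ∣ C 2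
      ≡⟨ cong (_+ ∣ W ∣ C 2) 
           (trans (sum-cong-≗ λ y → ind-cong (pairOf? (inside ∷ W) zero (suc y)) (y ∈? W)
                     (λ { (_ , _ , there q) → q }) λ q → s≤s z≤n , here , there q)
                  (∑-∈ W)) ⟩
    ∣ W ∣ + ∣ W ∣ C 2      ≡⟨ cong (_+ ∣ W ∣ C 2) (nC1≡n ∣ W ∣) ⟨
    ∣ W ∣ C 1 + ∣ W ∣ C 2  ≡⟨ nCk+nC[k+1]≡[n+1]C[k+1] ∣ W ∣ 1 ⟩
    suc ∣ W ∣ C 2          ∎

♯-pairOf-∅ : ♯ (pairOf? (∅ {n})) ≡ 0
♯-pairOf-∅ {n} = trans (♯-pairOf (∅ {n})) (cong (_C 2) (∣⊥∣≡0 n))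

∅-elim : {A : Set} {x y : Fin n} → PairOf ∅ x y → A
∅-elim (_ , x∈ , _) = ⊥-elim (∉⊥ x∈)

-- Pairs are stored with the smaller vertex first, so the end in `U` may come first or second.
Across : Subset n → Subset n → Fin n → Fin n → Set
Across U W x y = toℕ x < toℕ y × (x ∈ U × y ∈ W ⊎ x ∈ W × y ∈ U)

across? : (U W : Subset n) (x y : Fin n) → Dec (Across U W x y)
across? U W x y = (toℕ x <? toℕ y) ×-dec (((x ∈? U) ×-dec (y ∈? W)) ⊎-dec ((x ∈? W) ×-dec (y ∈? U)))

ind-×-distrib-⊎ : {L A B C D : Set} (L? : Dec L) (A? : Dec A) (B? : Dec B) (C? : Dec C) (D? : Dec D) → (A → C → ⊥) →
  ind (L? ×-dec ((A? ×-dec B?) ⊎-dec (C? ×-dec D?))) ≡ ind (L? ×-dec (A? ×-dec B?)) + ind (L? ×-dec (C? ×-dec D?))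
ind-×-distrib-⊎ (no _)  _ _ _ _ _ = refl
ind-×-distrib-⊎ (yes _) (yes a) _ (yes c) _ ac = ⊥-elim (ac a c)
ind-×-distrib-⊎ (yes _) (yes _) (yes _) (no _) _ _ = refl
ind-×-distrib-⊎ (yes _) (yes _) (no _)  (no _) _ _ = refl
ind-×-distrib-⊎ (yes _) (no _)  _ _ _ _ = refl

ind-trichotomy : {L G A B : Set} (L? : Dec L) (G? : Dec G) (A? : Dec A) (B? : Dec B) →
  (L → G → ⊥) → (A → B → ¬ L → ¬ G → ⊥) →
  ind (L? ×-dec (A? ×-dec B?)) + ind (G? ×-dec (B? ×-dec A?)) ≡ ind A? * ind B?
ind-trichotomy (yes l) (yes g) _ _ asym _ = ⊥-elim (asym l g)
ind-trichotomy (no ¬l) (no ¬g) (yes a) (yes b) _ tri = ⊥-elim (tri a b ¬l ¬g)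
ind-trichotomy (no _)  (no _)  (yes _) (no _)  _ _ = refl
ind-trichotomy (no _)  (no _)  (no _)  _       _ _ = refl
ind-trichotomy (yes _) (no _)  (yes _) (yes _) _ _ = refl
ind-trichotomy (yes _) (no _)  (yes _) (no _)  _ _ = refl
ind-trichotomy (yes _) (no _)  (no _)  _       _ _ = refl
ind-trichotomy (no _)  (yes _) (yes _) (yes _) _ _ = refl
ind-trichotomy (no _)  (yes _) (yes _) (no _)  _ _ = refl
ind-trichotomy (no _)  (yes _) (no _)  (yes _) _ _ = refl
ind-trichotomy (no _)  (yes _) (no _)  (no _)  _ _ = refl

-- The two orientations are counted separately and one of the sums is transposed. Since `U` and `W`
-- are disjoint, exactly one orientation of each element of their product is increasing, so the sums
-- together count the product.
♯-across : (U W : Subset n) → Disjoint U W → ♯ (across? U W) ≡ ∣ U ∣ * ∣ W ∣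
♯-across {n} U W dj = begin
  ♯ (across? U W)                          ≡⟨ sum-cong-≗ (λ x → sum-cong-≗ λ y → split x y) ⟩
  ∑ (λ x → ∑ λ y → f U W x y + f W U x y)  ≡⟨ ∑∑-distrib-+ (f U W) (f W U) ⟩
  ∑ (λ x → ∑ (f U W x)) + ∑ (λ x → ∑ (f W U x))
    ≡⟨ cong (∑ (λ x → ∑ (f U W x)) +_) (∑-comm (f W U)) ⟩
  ∑ (λ x → ∑ (f U W x)) + ∑ (λ x → ∑ λ y → f W U y x)
    ≡⟨ ∑∑-distrib-+ (f U W) (λ x y → f W U y x) ⟨
  ∑ (λ x → ∑ λ y → f U W x y + f W U y x)  ≡⟨ sum-cong-≗ (λ x → sum-cong-≗ λ y → join x y) ⟩
  ∑ (λ x → ∑ λ y → ind (x ∈? U) * ind (y ∈? W))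
    ≡⟨ sum-cong-≗ (λ x → *-distribˡ-sum (ind (x ∈? U)) (λ y → ind (y ∈? W))) ⟨
  ∑ (λ x → ind (x ∈? U) * ∑ (λ y → ind (y ∈? W)))
    ≡⟨ *-distribʳ-sum (∑ (λ y → ind (y ∈? W))) (λ x → ind (x ∈? U)) ⟨
  ∑ (λ x → ind (x ∈? U)) * ∑ (λ y → ind (y ∈? W)) ≡⟨ cong₂ _*_ (∑-∈ U) (∑-∈ W) ⟩
  ∣ U ∣ * ∣ W ∣ ∎
  where
  open ≡-Reasoning
  f? : (U W : Subset n) (x y : Fin n) → Dec (toℕ x < toℕ y × x ∈ U × y ∈ W)
  f? U W x y = (toℕ x <? toℕ y) ×-dec ((x ∈? U) ×-dec (y ∈? W))
  f : (U W : Subset n) (x y : Fin n) → ℕ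
  f U W x y = ind (f? U W x y)
  split : ∀ x y → ind (across? U W x y) ≡ f U W x y + f W U x y
  split x y = ind-×-distrib-⊎ (toℕ x <? toℕ y) (x ∈? U) (y ∈? W) (x ∈? W) (y ∈? U) dj
  join : ∀ x y → f U W x y + f W U y x ≡ ind (x ∈? U) * ind (y ∈? W)
  join x y = ind-trichotomy (toℕ x <? toℕ y) (toℕ y <? toℕ x) (x ∈? U) (y ∈? W) <-asym λ u w x≮y y≮x →
    dj u (subst (_∈ W) (sym (toℕ-injective (≤-antisym (≮⇒≥ y≮x) (≮⇒≥ x≮y)))) w)

-- Vertex sets of edge sets.

x∈⋃⁻ : ∀ {x : Fin n} ps → x ∈ ⋃ ps → ∃ λ p → p ∈ᴸ ps × x ∈ p
x∈⋃⁻ [] x∈ = ⊥-elim (∉⊥ x∈)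
x∈⋃⁻ (p ∷ ps) x∈ with x∈p∪q⁻ p (⋃ ps) x∈
... | inj₁ x∈p = p , here refl , x∈p
... | inj₂ x∈⋃ with q , q∈ , x∈q ← x∈⋃⁻ ps x∈⋃ = q , there q∈ , x∈q

module _ (E : Fin m → Subset n) where

  ∈V⁺ : ∀ {S i x} → i ∈ S → x ∈ E i → x ∈ V E S
  ∈V⁺ {S} {i} i∈S x∈Ei = go (∈-map⁺ E (∈-filter⁺ (_∈? S) (∈-allFin i) i∈S))
    where
    go : ∀ {ps} → E i ∈ᴸ ps → _ ∈ ⋃ ps
    go {p ∷ ps} (here refl) = p⊆p∪q (⋃ ps) x∈Ei
    go {p ∷ ps} (there i∈)  = q⊆p∪q p (⋃ ps) (go i∈)

  ∈V⁻ : ∀ {S x} → x ∈ V E S → ∃ λ i → i ∈ S × x ∈ E i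
  ∈V⁻ {S} x∈ with p , p∈ , x∈p ← x∈⋃⁻ (map E (filter (_∈? S) (allFin m))) x∈ with i , i∈ , refl ← ∈-map⁻ E p∈ =
    i , proj₂ (∈-filter⁻ (_∈? S) {xs = allFin m} i∈) , x∈p

  V-mono : ∀ {S S′} → S ⊆ S′ → V E S ⊆ V E S′
  V-mono S⊆S′ x∈ with i , i∈S , x∈Ei ← ∈V⁻ x∈ = ∈V⁺ (S⊆S′ i∈S) x∈Ei

  V-∪ : ∀ S w → V E (S ∪ w) ⊆ V E S ∪ V E w
  V-∪ S w x∈ with i , i∈ , x∈Ei ← ∈V⁻ x∈ with x∈p∪q⁻ S w i∈
  ... | inj₁ i∈S = p⊆p∪q (V E w) (∈V⁺ i∈S x∈Ei)
  ... | inj₂ i∈w = q⊆p∪q (V E S) (V E w) (∈V⁺ i∈w x∈Ei)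

  V-⁅⁆⁻ : ∀ {X} → V E ⁅ X ⁆ ⊆ E X
  V-⁅⁆⁻ {X} x∈ with i , i∈ , x∈Ei ← ∈V⁻ x∈ = subst (λ i → _ ∈ E i) (x∈⁅y⁆⇒x≡y X i∈) x∈Ei

  V-⁅⁆⁺ : ∀ {X} → E X ⊆ V E ⁅ X ⁆
  V-⁅⁆⁺ {X} = ∈V⁺ (x∈⁅x⁆ X)

  -- Chains, connected edge sets and clusters.

  chain-⊆ : ∀ {T T′ X Y} → T ⊆ T′ → Chain E T X Y → Chain E T′ X Y
  chain-⊆ T⊆T′ (here X∈T)          = here (T⊆T′ X∈T)
  chain-⊆ T⊆T′ (step X∈T XZ chain) = step (T⊆T′ X∈T) XZ (chain-⊆ T⊆T′ chain)

  chain-++ : ∀ {T X Y Z} → Chain E T X Y → Chain E T Y Z → Chain E T X Z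
  chain-++ (here _)            chain′ = chain′
  chain-++ (step X∈T XZ chain) chain′ = step X∈T XZ (chain-++ chain chain′)

  connected-⁅⁆ : ∀ X → Connected E ⁅ X ⁆
  connected-⁅⁆ X Y Z Y∈ Z∈ with refl ← x∈⁅y⁆⇒x≡y X Y∈ | refl ← x∈⁅y⁆⇒x≡y X Z∈ = here Y∈

  connected-∪ : ∀ {T T′ X Y} → Connected E T → Connected E T′ → X ∈ T → Y ∈ T′ →
                2 ≤ ∣ E X ∩ E Y ∣ → Connected E (T ∪ T′)
  connected-∪ {T} {T′} {X} {Y} conn conn′ X∈T Y∈T′ XY Z W Z∈ W∈
    with x∈p∪q⁻ T T′ Z∈ | x∈p∪q⁻ T T′ W∈
  ... | inj₁ Z∈T  | inj₁ W∈T  = chain-⊆ (p⊆p∪q T′) (conn Z W Z∈T W∈T)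
  ... | inj₂ Z∈T′ | inj₂ W∈T′ = chain-⊆ (q⊆p∪q T T′) (conn′ Z W Z∈T′ W∈T′)
  ... | inj₁ Z∈T  | inj₂ W∈T′ = chain-++ (chain-⊆ (p⊆p∪q T′) (conn Z X Z∈T X∈T))
    (step (p⊆p∪q T′ X∈T) XY (chain-⊆ (q⊆p∪q T T′) (conn′ Y W Y∈T′ W∈T′)))
  ... | inj₂ Z∈T′ | inj₁ W∈T = chain-++ (chain-⊆ (q⊆p∪q T T′) (conn′ Z Y Z∈T′ Y∈T′))
    (step (q⊆p∪q T T′ Y∈T′) (subst (2 ≤_) (cong ∣_∣ (∩-comm (E X) (E Y))) XY)
          (chain-⊆ (p⊆p∪q T′) (conn X W X∈T W∈T)))

  -- The union of `T` and `T′` is again connected, so the maximality of `T` applies to it.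
  cluster-absorbs : ∀ {T T′ X Y} → OneCluster E T → Connected E T′ → X ∈ T → Y ∈ T′ →
                    2 ≤ ∣ E X ∩ E Y ∣ → T′ ⊆ T
  cluster-absorbs {T} {T′} (_ , conn , maximal) conn′ X∈T Y∈T′ XY Z∈T′ =
    maximal (T ∪ T′) (connected-∪ conn conn′ X∈T Y∈T′ XY) (p⊆p∪q T′) (q⊆p∪q T T′ Z∈T′)

  cluster-closed : ∀ {T X Y} → OneCluster E T → X ∈ T → 2 ≤ ∣ E X ∩ E Y ∣ → Y ∈ T
  cluster-closed {Y = Y} cl X∈T XY = cluster-absorbs cl (connected-⁅⁆ Y) X∈T (x∈⁅x⁆ Y) XY (x∈⁅x⁆ Y)

  -- Takes the first link of the chain that leaves `S`. This supplies the next edge when a cluster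
  -- is built edge by edge.
  crossing : ∀ {T S X Y} → Chain E T X Y → X ∈ S → Y ∉ S →
             ∃ λ Z → ∃ λ W → Z ∈ S × W ∈ T × W ∉ S × 2 ≤ ∣ E Z ∩ E W ∣
  crossing (here _) X∈S Y∉S = ⊥-elim (Y∉S X∈S)
  crossing {S = S} (step {Z = Z} X∈T XZ chain) X∈S Y∉S with Z ∈? S
  ... | yes Z∈S = crossing chain Z∈S Y∉S
  ... | no  Z∉S = _ , Z , X∈S , source chain , Z∉S , XZ
    where
    source : ∀ {T X Y} → Chain E T X Y → X ∈ T
    source (here X∈T)     = X∈T
    source (step X∈T _ _) = X∈T

-- Tight edge sets in a free hypergraph.

module FreeHypergraph {m n d k : ℕ} (2≤k : 2 ≤ k) (E : Fin m → Subset n)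
  (uniform : ∀ i → ∣ E i ∣ ≡ 2 + d) (free : GkFree (2 + d) (suc k) E) where

  Tight : Subset m → Set
  Tight S = ∣ V E S ∣ ≤ d * ∣ S ∣ + 2

  ¬tight : ∀ {S} → ∣ S ∣ ≡ suc k → ¬ Tight S
  ¬tight {S} S≡k tight = proj₁ free S S≡k (subst (λ s → ∣ V E S ∣ ≤ d * s + 2) S≡k tight)

  -- Sizes up to `k` are excluded by the second half of `GkFree`. At size `suc k` even tightness is
  -- forbidden, and the bound here is stronger.
  ¬overtight : ∀ {S} → 2 ≤ ∣ S ∣ → ∣ S ∣ ≤ suc k → ¬ ∣ V E S ∣ ≤ d * ∣ S ∣ + 1
  ¬overtight {S} 2≤S S≤k over with m≤n⇒m<n∨m≡n S≤k
  ... | inj₁ (s≤s S≤) = proj₂ free S 2≤S S≤ over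
  ... | inj₂ S≡k = ¬tight S≡k (≤-trans over (+-monoʳ-≤ (d * ∣ S ∣) (s≤s z≤n)))

  tight-⁅⁆ : ∀ X → Tight ⁅ X ⁆
  tight-⁅⁆ X = begin
    ∣ V E ⁅ X ⁆ ∣      ≤⟨ p⊆q⇒∣p∣≤∣q∣ (V-⁅⁆⁻ E) ⟩
    ∣ E X ∣            ≡⟨ uniform X ⟩
    2 + d              ≡⟨ +-comm 2 d ⟩
    d + 2              ≡⟨ cong (_+ 2) (*-identityʳ d) ⟨
    d * 1 + 2          ≡⟨ cong (λ s → d * s + 2) (∣⁅x⁆∣≡1 X) ⟨
    d * ∣ ⁅ X ⁆ ∣ + 2  ∎
    where open ≤-Reasoning

  ∣V∣-lower : ∀ {S} → 1 ≤ ∣ S ∣ → ∣ S ∣ ≤ k → d * ∣ S ∣ + 2 ≤ ∣ V E S ∣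
  ∣V∣-lower {S} 1≤S S≤k with m≤n⇒m<n∨m≡n 1≤S
  ... | inj₁ 2≤S = subst (_≤ ∣ V E S ∣) (sym (+-suc (d * ∣ S ∣) 1)) (≰⇒> (¬overtight 2≤S (m≤n⇒m≤1+n S≤k)))
  ... | inj₂ 1≡S with X , X∈S ← 1≤∣p∣⇒nonempty 1≤S = begin
    d * ∣ S ∣ + 2 ≡⟨ cong (λ s → d * s + 2) 1≡S ⟨
    d * 1 + 2     ≡⟨ cong (_+ 2) (*-identityʳ d) ⟩
    d + 2         ≡⟨ +-comm d 2 ⟩
    2 + d         ≡⟨ uniform X ⟨
    ∣ E X ∣       ≤⟨ p⊆q⇒∣p∣≤∣q∣ (∈V⁺ E X∈S) ⟩
    ∣ V E S ∣     ∎
    where open ≤-Reasoning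

  -- Inclusion-exclusion on the vertex sets, with the shared vertices kept on the left to avoid
  -- subtraction. Taking `c` to be 2 gives a tight union, taking it to be 3 an overtight one.
  ∪-bound : ∀ {S w c} → Disjoint S w → Tight S → Tight w → c ≤ ∣ V E S ∩ V E w ∣ →
            ∣ V E (S ∪ w) ∣ + c ≤ d * ∣ S ∪ w ∣ + 4
  ∪-bound {S} {w} {c} dj tS tw c≤ = begin
    ∣ V E (S ∪ w) ∣ + c                        ≤⟨ +-mono-≤ (p⊆q⇒∣p∣≤∣q∣ (V-∪ E S w)) c≤ ⟩
    ∣ V E S ∪ V E w ∣ + ∣ V E S ∩ V E w ∣      ≡⟨ ∣p∪q∣+∣p∩q∣≡∣p∣+∣q∣ (V E S) (V E w) ⟩
    ∣ V E S ∣ + ∣ V E w ∣                      ≤⟨ +-mono-≤ tS tw ⟩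
    (d * ∣ S ∣ + 2) + (d * ∣ w ∣ + 2)
      ≡⟨ solve 3 (λ d s w → (d :* s :+ con 2) :+ (d :* w :+ con 2) := d :* (s :+ w) :+ con 4) refl d ∣ S ∣ ∣ w ∣ ⟩
    d * (∣ S ∣ + ∣ w ∣) + 4                    ≡⟨ cong (λ s → d * s + 4) (∣p∪q∣-disjoint S w dj) ⟨
    d * ∣ S ∪ w ∣ + 4                          ∎
    where
    open ≤-Reasoning
    open +-*-Solver

  tight-∪ : ∀ {S w} → Disjoint S w → Tight S → Tight w → 2 ≤ ∣ V E S ∩ V E w ∣ → Tight (S ∪ w)
  tight-∪ {S} {w} dj tS tw 2≤ = +-cancelʳ-≤ 2 _ _
    (≤-trans (∪-bound dj tS tw 2≤) (≤-reflexive (sym (+-assoc (d * ∣ S ∪ w ∣) 2 2))))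

  ¬share3 : ∀ {S w} → Disjoint S w → Tight S → Tight w → 1 ≤ ∣ S ∣ → 1 ≤ ∣ w ∣ → ∣ S ∪ w ∣ ≤ suc k →
            ¬ 3 ≤ ∣ V E S ∩ V E w ∣
  ¬share3 {S} {w} dj tS tw 1≤S 1≤w ≤k 3≤ = ¬overtight
    (≤-trans (+-mono-≤ 1≤S 1≤w) (≤-reflexive (sym (∣p∪q∣-disjoint S w dj)))) ≤k
    (+-cancelʳ-≤ 3 _ _ (≤-trans (∪-bound dj tS tw 3≤) (≤-reflexive (sym (+-assoc (d * ∣ S ∪ w ∣) 1 3)))))

  -- Pairs of vertices spanned by tight sets.

  Edge : Subset m → Fin n → Fin n → Set
  Edge F x y = ∃ λ X → X ∈ F × x ∈ E X × y ∈ E X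

  Spans : ℕ → Subset m → Fin n → Fin n → Set
  Spans i F x y = ∃ λ S → S ⊆ F × ∣ S ∣ ≡ i × Tight S × x ∈ V E S × y ∈ V E S

  -- By `∣V∣-lower` the set `V E S` alone already fills the bound in `InC`, so adding `x` and `y`
  -- cannot enlarge it: both are vertices of `S`, and `S` is tight.
  InC⇒Spans : ∀ {i F x y} → 1 ≤ i → i ≤ k → InC (2 + d) E F x y i → Spans i F x y
  InC⇒Spans {x = x} {y} 1≤i i≤k (S , S⊆F , refl , bound) =
    S , S⊆F , refl , ≤-trans (∣q∣≤∣p∪q∣ (⁅ x ⁆ ∪ ⁅ y ⁆) (V E S)) bound ,
    covered (p⊆p∪q (V E S) (p⊆p∪q ⁅ y ⁆ (x∈⁅x⁆ x))) ,
    covered (p⊆p∪q (V E S) (q⊆p∪q ⁅ x ⁆ ⁅ y ⁆ (x∈⁅x⁆ y)))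
    where
    covered : (⁅ x ⁆ ∪ ⁅ y ⁆) ∪ V E S ⊆ V E S
    covered = p⊆q∧∣q∣≤∣p∣⇒q⊆p (q⊆p∪q _ _) (≤-trans bound (∣V∣-lower 1≤i i≤k))

  Spans⇒InC : ∀ {i F x y} → Spans i F x y → InC (2 + d) E F x y i
  Spans⇒InC (S , S⊆F , refl , tight , x∈ , y∈) =
    S , S⊆F , refl , ≤-trans (p⊆q⇒∣p∣≤∣q∣ (∪-lub (⁅x⁆∪⁅y⁆⊆ x∈ y∈) id)) tight

  Spans⇒Edge : ∀ {F x y} → Spans 1 F x y → Edge F x y
  Spans⇒Edge (S , S⊆F , S≡1 , _ , x∈ , y∈)
    with X , X∈S , x∈X ← ∈V⁻ E x∈ | Y , Y∈S , y∈Y ← ∈V⁻ E y∈ with X ≟ᶠ Y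
  ... | yes refl = X , S⊆F X∈S , x∈X , y∈Y
  ... | no  X≢Y  = contradiction (subst (2 ≤_) S≡1 (x≢y⇒2≤∣p∣ X≢Y X∈S Y∈S)) λ { (s≤s ()) }

  Edge⇒Spans : ∀ {F x y} → Edge F x y → Spans 1 F x y
  Edge⇒Spans (X , X∈F , x∈X , y∈X) =
    ⁅ X ⁆ , ⁅x⁆⊆ X∈F , ∣⁅x⁆∣≡1 X , tight-⁅⁆ X , V-⁅⁆⁺ E x∈X , V-⁅⁆⁺ E y∈X

  Spans-mono : ∀ {i F F′ x y} → F ⊆ F′ → Spans i F x y → Spans i F′ x y
  Spans-mono F⊆F′ (S , S⊆F , rest) = S , (λ X∈S → F⊆F′ (S⊆F X∈S)) , rest

  Spans⇒∈V : ∀ {i F x y} → Spans i F x y → x ∈ V E F × y ∈ V E F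
  Spans⇒∈V (S , S⊆F , _ , _ , x∈ , y∈) = V-mono E S⊆F x∈ , V-mono E S⊆F y∈

  Edge-∪⁻ : ∀ {A B x y} → Edge (A ∪ B) x y → Edge A x y ⊎ Edge B x y
  Edge-∪⁻ {A} {B} (X , X∈ , xy) with x∈p∪q⁻ A B X∈
  ... | inj₁ X∈A = inj₁ (X , X∈A , xy)
  ... | inj₂ X∈B = inj₂ (X , X∈B , xy)

  -- Growth by tight pieces of one or two edges.

  Piece : Subset m → Set
  Piece w = 1 ≤ ∣ w ∣ × ∣ w ∣ ≤ 2 × Tight w

  piece-⁅⁆ : ∀ X → Piece ⁅ X ⁆
  piece-⁅⁆ X = ≤-reflexive (sym (∣⁅x⁆∣≡1 X)) , ≤-trans (≤-reflexive (∣⁅x⁆∣≡1 X)) (s≤s z≤n) , tight-⁅⁆ X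

  Extension : Subset m → Subset m → Set
  Extension A S = ∃ λ w → w ⊆ A × Disjoint S w × Piece w × 2 ≤ ∣ V E S ∩ V E w ∣

  -- The substitute for connectivity that survives merging. Clusters have it with single edges as
  -- pieces; a merge along a pair adds the one- or two-edge sets spanning that pair as bridges.
  Expandable : Subset m → Set
  Expandable A = ∀ {S} → S ⊆ A → Nonempty S → ¬ A ⊆ S → Extension A S

  ∣∩V∣-mono : ∀ {c S S′ w} → S ⊆ S′ → c ≤ ∣ V E S ∩ V E w ∣ → c ≤ ∣ V E S′ ∩ V E w ∣
  ∣∩V∣-mono {w = w} S⊆S′ c≤ = ≤-trans c≤ (p⊆q⇒∣p∣≤∣q∣ (∩-mono {q = V E w} (V-mono E S⊆S′) id))

  extension-⊆ : ∀ {A A′ S} → A ⊆ A′ → Extension A S → Extension A′ S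
  extension-⊆ A⊆A′ (w , w⊆A , rest) = w , (λ X∈w → A⊆A′ (w⊆A X∈w)) , rest

  -- The piece found for `S ∩ A` lies in `A`, so avoiding `S ∩ A` it avoids all of `S`.
  extension-∩ : ∀ {A S} → Expandable A → Nonempty (S ∩ A) → ¬ A ⊆ S → Extension A S
  extension-∩ {A} {S} expand ne A⊈S
    with w , w⊆A , dj , piece , 2≤ ← expand (p∩q⊆q S A) ne (λ A⊆ → A⊈S λ X∈A → p∩q⊆p S A (A⊆ X∈A)) =
    w , w⊆A , (λ X∈S X∈w → dj (x∈p∩q⁺ (X∈S , w⊆A X∈w)) X∈w) , piece , ∣∩V∣-mono (p∩q⊆p S A) 2≤

  -- If `S` meets one of `A`, `B` without containing it, it extends inside that side. Otherwise it
  -- contains one side and misses the other, and then the bridge `a` or `b` on the missed side is a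
  -- new piece, sharing two vertices with the bridge already in `S`.
  expandable-∪ : ∀ {A B a b} → Expandable A → Expandable B →
    a ⊆ A → b ⊆ B → Piece a → Piece b → 2 ≤ ∣ V E a ∩ V E b ∣ → Expandable (A ∪ B)
  expandable-∪ {A} {B} {a} {b} expA expB a⊆A b⊆B pa pb 2≤ {S} S⊆ (X , X∈S) ⊈S
    with nonempty? (S ∩ A) | A ⊆? S | nonempty? (S ∩ B) | B ⊆? S
  ... | yes neA | no A⊈S | _ | _ = extension-⊆ (p⊆p∪q B) (extension-∩ expA neA A⊈S)
  ... | _ | _ | yes neB | no B⊈S = extension-⊆ (q⊆p∪q A B) (extension-∩ expB neB B⊈S)
  ... | _ | yes A⊆S | _ | yes B⊆S = ⊥-elim (⊈S (∪-lub A⊆S B⊆S))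
  ... | _ | yes A⊆S | no ¬neB | no _ =
    b , (λ Y∈b → q⊆p∪q A B (b⊆B Y∈b)) , (λ Y∈S Y∈b → ¬neB (_ , x∈p∩q⁺ (Y∈S , b⊆B Y∈b))) , pb ,
    ∣∩V∣-mono (λ Y∈a → A⊆S (a⊆A Y∈a)) 2≤
  ... | no ¬neA | no _ | _ | yes B⊆S =
    a , (λ Y∈a → p⊆p∪q B (a⊆A Y∈a)) , (λ Y∈S Y∈a → ¬neA (_ , x∈p∩q⁺ (Y∈S , a⊆A Y∈a))) , pa ,
    ∣∩V∣-mono (λ Y∈b → B⊆S (b⊆B Y∈b)) (subst (2 ≤_) (cong ∣_∣ (∩-comm (V E a) (V E b))) 2≤)
  ... | no ¬neA | no _ | no ¬neB | no _ with x∈p∪q⁻ A B (S⊆ X∈S)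
  ... | inj₁ X∈A = ⊥-elim (¬neA (X , x∈p∩q⁺ (X∈S , X∈A)))
  ... | inj₂ X∈B = ⊥-elim (¬neB (X , x∈p∩q⁺ (X∈S , X∈B)))

  disjoint-⁅⁆ : ∀ {X} {S : Subset m} → X ∉ S → Disjoint S ⁅ X ⁆
  disjoint-⁅⁆ {X} {S} X∉S Y∈S Y∈ = X∉S (subst (_∈ S) (x∈⁅y⁆⇒x≡y X Y∈) Y∈S)

  ∣∪⁅⁆∣ : ∀ {X} {S : Subset m} → X ∉ S → ∣ S ∪ ⁅ X ⁆ ∣ ≡ suc ∣ S ∣
  ∣∪⁅⁆∣ {X} {S} X∉S = trans (∣p∪q∣-disjoint S ⁅ X ⁆ (disjoint-⁅⁆ X∉S))
    (trans (cong (∣ S ∣ +_) (∣⁅x⁆∣≡1 X)) (+-comm ∣ S ∣ 1))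

  -- Neither S nor S ∪ {X} may have the forbidden size k + 1, so S may be enlarged by two more edges.
  room : ∀ {X S} → X ∉ S → Tight S → 2 ≤ ∣ V E S ∩ V E ⁅ X ⁆ ∣ → ∣ S ∣ ≤ suc k → ∣ S ∣ < k
  room {X} {S} X∉S tight 2≤ S≤ with m≤n⇒m<n∨m≡n S≤
  ... | inj₂ S≡ = ⊥-elim (¬tight S≡ tight)
  ... | inj₁ (s≤s S≤k) with m≤n⇒m<n∨m≡n S≤k
  ... | inj₁ S<k = S<k
  ... | inj₂ S≡k = ⊥-elim (¬tight (trans (∣∪⁅⁆∣ X∉S) (cong suc S≡k))
                                  (tight-∪ (disjoint-⁅⁆ X∉S) tight (tight-⁅⁆ X) 2≤))

  ∣∪piece∣> : ∀ {S w} → Disjoint S w → Piece w → ∣ S ∣ < ∣ S ∪ w ∣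
  ∣∪piece∣> {S} {w} dj (1≤w , _) = begin
    suc ∣ S ∣      ≡⟨ +-comm 1 ∣ S ∣ ⟩
    ∣ S ∣ + 1      ≤⟨ +-monoʳ-≤ ∣ S ∣ 1≤w ⟩
    ∣ S ∣ + ∣ w ∣  ≡⟨ ∣p∪q∣-disjoint S w dj ⟨
    ∣ S ∪ w ∣      ∎
    where open ≤-Reasoning

  -- Here the cap of two edges per piece matters: one extension cannot jump over the size `suc k`,
  -- so `room` can be applied again afterwards.
  ∣∪piece∣≤ : ∀ {S w} → Disjoint S w → Piece w → ∣ S ∣ < k → ∣ S ∪ w ∣ ≤ suc k
  ∣∪piece∣≤ {S} {w} dj (_ , w≤2 , _) S<k = begin
    ∣ S ∪ w ∣      ≡⟨ ∣p∪q∣-disjoint S w dj ⟩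
    ∣ S ∣ + ∣ w ∣  ≤⟨ +-monoʳ-≤ ∣ S ∣ w≤2 ⟩
    ∣ S ∣ + 2      ≡⟨ +-comm ∣ S ∣ 2 ⟩
    2 + ∣ S ∣      ≤⟨ s≤s S<k ⟩
    suc k          ∎
    where open ≤-Reasoning

  -- Growing from `e`, `tight-∪` preserves tightness, while the outside edge `X` always shares the
  -- two vertices it shares with `e`; hence `room` brings the size back below `k` after every
  -- extension.
  expandable⇒tight : ∀ {B X e} → Expandable B → X ∉ B → e ⊆ B → Piece e → 2 ≤ ∣ V E e ∩ V E ⁅ X ⁆ ∣ →
                     Tight B × ∣ B ∣ < k
  expandable⇒tight {B} {X} {e} expand X∉B e⊆B (1≤e , e≤2 , te) 2≤ =
    -- The first use of `room` needs `e` to have at most `suc k` edges, which holds because a piece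
    -- has at most two and `2 ≤ k`.
    let _ , tB , B<k , _ = grow Inv extend e⊆B
          (1≤∣p∣⇒nonempty 1≤e , te , room (λ X∈ → X∉B (e⊆B X∈)) te 2≤ (m≤n⇒m≤1+n (≤-trans e≤2 2≤k)) , 2≤)
    in tB , B<k
    where
    Inv : Subset m → Set
    Inv S = Nonempty S × Tight S × ∣ S ∣ < k × 2 ≤ ∣ V E S ∩ V E ⁅ X ⁆ ∣
    extend : ∀ {S} → S ⊆ B → ¬ B ⊆ S → Inv S → ∃ λ S′ → S′ ⊆ B × ∣ S ∣ < ∣ S′ ∣ × Inv S′
    extend {S} S⊆B B⊈S ((Y , Y∈S) , tS , S<k , 2≤S)
      with w , w⊆B , dj , pw , 2≤w ← expand S⊆B (Y , Y∈S) B⊈S =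
      S ∪ w , ∪-lub S⊆B w⊆B , ∣∪piece∣> dj pw ,
      (Y , p⊆p∪q w Y∈S) , tSw , room (λ X∈ → X∉B (∪-lub S⊆B w⊆B X∈)) tSw 2≤Sw (∣∪piece∣≤ dj pw S<k) , 2≤Sw
      where
      tSw = tight-∪ dj tS (proj₂ (proj₂ pw)) 2≤w
      2≤Sw = ∣∩V∣-mono (p⊆p∪q w) 2≤S

  -- If u lay outside {x,y}, growing w inside A until it covers {x,y} would produce two tight sets
  -- with three common vertices.
  shared⇒∈pair : ∀ {A B X w x y u} → Expandable A → Disjoint A B → Tight B → 1 ≤ ∣ B ∣ → ∣ B ∣ < k →
    X ∈ A → x ≢ y → x ∈ E X → y ∈ E X → x ∈ V E B → y ∈ V E B →
    w ⊆ A → Piece w → 2 ≤ ∣ V E B ∩ V E w ∣ → u ∈ V E B → u ∈ V E w → u ∈ ⁅ x ⁆ ∪ ⁅ y ⁆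
  shared⇒∈pair {A} {B} {X} {w} {x} {y} {u} expand dj tB 1≤B B<k X∈A x≢y x∈X y∈X x∈B y∈B w⊆A pw 2≤w u∈B u∈w
    with u ∈? (⁅ x ⁆ ∪ ⁅ y ⁆)
  ... | yes u∈ = u∈
  -- The growth starts at `w`, where `∣ B ∣ < k` keeps `B ∪ w` within `suc k` edges. It ends at `A`,
  -- whose edge `X` covers both `x` and `y`.
  ... | no  u∉ = ⊥-elim $ impossible {A} id
        (grow Inv extend w⊆A (1≤∣p∣⇒nonempty (proj₁ pw) , proj₂ (proj₂ pw) , ∣∪piece∣≤ (dj-⊆ w⊆A) pw B<k , 2≤w , u∈w))
        (∈V⁺ E X∈A x∈X) (∈V⁺ E X∈A y∈X)
    where
    Inv : Subset m → Set
    Inv S = Nonempty S × Tight S × ∣ B ∪ S ∣ ≤ suc k × 2 ≤ ∣ V E B ∩ V E S ∣ × u ∈ V E S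
    dj-⊆ : ∀ {S} → S ⊆ A → Disjoint B S
    dj-⊆ S⊆A Y∈B Y∈S = dj (S⊆A Y∈S) Y∈B
    impossible : ∀ {S} → S ⊆ A → Inv S → x ∈ V E S → y ∈ V E S → ⊥
    impossible S⊆A (ne , tS , ≤k , _ , u∈S) x∈S y∈S =
      ¬share3 (dj-⊆ S⊆A) tB tS 1≤B (nonempty⇒1≤∣p∣ ne) ≤k
        (x∉yz⇒3≤∣p∣ {p = V E B ∩ V E _} x≢y u∉ (x∈p∩q⁺ (u∈B , u∈S)) (x∈p∩q⁺ (x∈B , x∈S)) (x∈p∩q⁺ (y∈B , y∈S)))
    extend : ∀ {S} → S ⊆ A → ¬ A ⊆ S → Inv S → ∃ λ S′ → S′ ⊆ A × ∣ S ∣ < ∣ S′ ∣ × Inv S′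
    extend {S} S⊆A A⊈S inv@((Y , Y∈S) , tS , ≤k , 2≤S , u∈S)
      with w′ , w′⊆A , dj′ , pw′ , 2≤w′ ← expand S⊆A (Y , Y∈S) A⊈S =
      S ∪ w′ , ∪-lub S⊆A w′⊆A , ∣∪piece∣> dj′ pw′ ,
      (Y , p⊆p∪q w′ Y∈S) , tight-∪ dj′ tS (proj₂ (proj₂ pw′)) 2≤w′ ,
      subst (λ T → ∣ T ∣ ≤ suc k) (∪-assoc B S w′) (∣∪piece∣≤ dj″ pw′ BS<k) ,
      ≤-trans 2≤S (p⊆q⇒∣p∣≤∣q∣ (∩-mono {p = V E B} id (V-mono E (p⊆p∪q w′)))) , V-mono E (p⊆p∪q w′) u∈S
      where
      -- Had `S` absorbed `X`, it would cover `x` and `y` and be contradictory already. So `X` lies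
      -- outside `B ∪ S`, and `room` can be applied with it.
      X∉S : X ∉ S
      X∉S X∈S = impossible S⊆A inv (∈V⁺ E X∈S x∈X) (∈V⁺ E X∈S y∈X)
      BS<k : ∣ B ∪ S ∣ < k
      BS<k = room (λ X∈ → [ dj X∈A , X∉S ]′ (x∈p∪q⁻ B S X∈))
        (tight-∪ (dj-⊆ S⊆A) tB tS 2≤S)
        (x≢y⇒2≤∣p∣ x≢y (x∈p∩q⁺ (V-mono E (p⊆p∪q S) x∈B , V-⁅⁆⁺ E x∈X))
                       (x∈p∩q⁺ (V-mono E (p⊆p∪q S) y∈B , V-⁅⁆⁺ E y∈X))) ≤k
      dj″ : Disjoint (B ∪ S) w′
      dj″ Z∈ Z∈w′ with x∈p∪q⁻ B S Z∈
      ... | inj₁ Z∈B = dj (w′⊆A Z∈w′) Z∈B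
      ... | inj₂ Z∈S = dj′ Z∈S Z∈w′

  -- The side `B` that spans the merging pair with two edges is tight and small by
  -- `expandable⇒tight`, with the edge `X` of `A` as the outside edge; this is what `shared⇒∈pair`
  -- needs.
  merge⇒∈pair : ∀ {A B x y} → Expandable A → Expandable B → Disjoint A B → x ≢ y → Edge A x y → Spans 2 B x y →
    ∀ {i u v} → 1 ≤ i → i ≤ 2 → u ≢ v → u ∈ V E B → v ∈ V E B → Spans i A u v → u ∈ ⁅ x ⁆ ∪ ⁅ y ⁆ × v ∈ ⁅ x ⁆ ∪ ⁅ y ⁆
  merge⇒∈pair {A} {B} {x} {y} expA expB dj x≢y (X , X∈A , x∈X , y∈X) (e , e⊆B , e≡2 , te , x∈e , y∈e)
    1≤i i≤2 u≢v u∈B v∈B (w , w⊆A , refl , tw , u∈w , v∈w) =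
    inPair u∈B u∈w , inPair v∈B v∈w
    where
    B-tight : Tight B × ∣ B ∣ < k
    B-tight = expandable⇒tight expB (dj X∈A) e⊆B (≤-trans (s≤s z≤n) (≤-reflexive (sym e≡2)) , ≤-reflexive e≡2 , te)
      (x≢y⇒2≤∣p∣ x≢y (x∈p∩q⁺ (x∈e , V-⁅⁆⁺ E x∈X)) (x∈p∩q⁺ (y∈e , V-⁅⁆⁺ E y∈X)))
    inPair : ∀ {u} → u ∈ V E B → u ∈ V E w → u ∈ ⁅ x ⁆ ∪ ⁅ y ⁆
    inPair = shared⇒∈pair expA dj (proj₁ B-tight)
      (≤-trans (≤-trans (s≤s z≤n) (≤-reflexive (sym e≡2))) (p⊆q⇒∣p∣≤∣q∣ e⊆B)) (proj₂ B-tight)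
      X∈A x≢y x∈X y∈X (V-mono E e⊆B x∈e) (V-mono E e⊆B y∈e)
      w⊆A (1≤i , i≤2 , tw)
      (x≢y⇒2≤∣p∣ u≢v (x∈p∩q⁺ (u∈B , u∈w)) (x∈p∩q⁺ (v∈B , v∈w)))

  -- The two pair counts under a merge.

  P₁ : Subset m → Fin n → Fin n → Set
  P₁ F x y = PairIn E F (x , y) × InC (2 + d) E F x y 1

  P₁? : ∀ F x y → Dec (P₁ F x y)
  P₁? F x y = PairIn? E F (x , y) ×-dec InC? (2 + d) E F x y 1

  P₁card≡♯ : ∀ F → P1card (2 + d) E F ≡ ♯ (P₁? F)
  P₁card≡♯ F = length-filter-allPairs {n} _

  P₁⁻ : ∀ {F x y} → P₁ F x y → toℕ x < toℕ y × Edge F x y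
  P₁⁻ ((x<y , _) , in₁) = x<y , Spans⇒Edge (InC⇒Spans ≤-refl (≤-trans (s≤s z≤n) 2≤k) in₁)

  P₁⁺ : ∀ {F x y} → toℕ x < toℕ y → Edge F x y → P₁ F x y
  P₁⁺ x<y edge = (x<y , Spans⇒∈V (Edge⇒Spans edge)) , Spans⇒InC (Edge⇒Spans edge)

  P₁₂ : Subset m → Fin n → Fin n → Set
  P₁₂ F x y = PairIn E F (x , y) × (InC (2 + d) E F x y 2 × ¬ InC (2 + d) E F x y 1)

  P₁₂? : ∀ F x y → Dec (P₁₂ F x y)
  P₁₂? F x y = PairIn? E F (x , y) ×-dec (InC? (2 + d) E F x y 2 ×-dec ¬? (InC? (2 + d) E F x y 1))

  P₁₂card≡♯ : ∀ F → P12card (2 + d) E F ≡ ♯ (P₁₂? F)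
  P₁₂card≡♯ F = length-filter-allPairs {n} _

  P₁₂⁻ : ∀ {F x y} → P₁₂ F x y → toℕ x < toℕ y × Spans 2 F x y × ¬ Edge F x y
  P₁₂⁻ ((x<y , _) , in₂ , ∉₁) =
    x<y , InC⇒Spans (s≤s z≤n) 2≤k in₂ , λ edge → ∉₁ (Spans⇒InC (Edge⇒Spans edge))

  P₁₂⁺ : ∀ {F x y} → toℕ x < toℕ y → Spans 2 F x y → ¬ Edge F x y → P₁₂ F x y
  P₁₂⁺ x<y spans ¬edge = (x<y , Spans⇒∈V spans) , Spans⇒InC spans ,
    λ in₁ → ¬edge (Spans⇒Edge (InC⇒Spans ≤-refl (≤-trans (s≤s z≤n) 2≤k) in₁))

  toℕ<⇒≢ : {x y : Fin n} → toℕ x < toℕ y → x ≢ y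
  toℕ<⇒≢ x<x refl = n≮n _ x<x

  -- A pair is lost only by lying in an edge of the other side. It is then spanned on both sides, so
  -- `merge⇒∈pair` identifies it with the merging pair, whence the single `1`. A pair counted on
  -- both sides would likewise be the merging pair, but that one lies in the edge `X` of `A`.
  P₁₂-∪ : ∀ {A B x y} → Expandable A → Expandable B → Disjoint A B → x ≢ y → Edge A x y → Spans 2 B x y →
          P12card (2 + d) E A + P12card (2 + d) E B ≤ P12card (2 + d) E (A ∪ B) + 1
  P₁₂-∪ {A} {B} {x} {y} expA expB dj x≢y edge@(X , X∈A , x∈X , y∈X) spans = begin
    P12card (2 + d) E A + P12card (2 + d) E B  ≡⟨ cong₂ _+_ (P₁₂card≡♯ A) (P₁₂card≡♯ B) ⟩
    ♯ (P₁₂? A) + ♯ (P₁₂? B)                    ≤⟨ ♯-modular (P₁₂? A) (P₁₂? B) (P₁₂? (A ∪ B)) (pairOf? p) fromA fromB fromBoth ⟩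
    ♯ (P₁₂? (A ∪ B)) + ♯ (pairOf? p)           ≡⟨ cong₂ _+_ (sym (P₁₂card≡♯ (A ∪ B))) (♯-pairOf p) ⟩
    P12card (2 + d) E (A ∪ B) + ∣ p ∣ C 2      ≡⟨ cong (λ s → P12card (2 + d) E (A ∪ B) + s C 2) (x≢y⇒∣⁅x⁆∪⁅y⁆∣≡2 x≢y) ⟩
    P12card (2 + d) E (A ∪ B) + 1              ∎
    where
    open ≤-Reasoning
    p = ⁅ x ⁆ ∪ ⁅ y ⁆
    inPair : ∀ {i j u v} → 1 ≤ i → i ≤ 2 → toℕ u < toℕ v → Spans i A u v → Spans j B u v → PairOf p u v
    inPair 1≤i i≤2 u<v sA sB = let u∈ , v∈ = Spans⇒∈V sB in
      u<v , merge⇒∈pair expA expB dj x≢y edge spans 1≤i i≤2 (toℕ<⇒≢ u<v) u∈ v∈ sA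
    pair⇒Edge : ∀ {u v} → PairOf p u v → Edge A u v
    pair⇒Edge (_ , u∈p , v∈p) = X , X∈A , ⁅x⁆∪⁅y⁆⊆ x∈X y∈X u∈p , ⁅x⁆∪⁅y⁆⊆ x∈X y∈X v∈p
    fromA : ∀ {u v} → P₁₂ A u v → P₁₂ (A ∪ B) u v ⊎ PairOf p u v
    fromA {u} {v} PA with u<v , sA , ¬eA ← P₁₂⁻ PA with pairOf? p u v
    ... | yes in-p = inj₂ in-p
    ... | no ∉p = inj₁ (P₁₂⁺ u<v (Spans-mono (p⊆p∪q B) sA) λ e →
      [ ¬eA , (λ eB → ∉p (inPair (s≤s z≤n) ≤-refl u<v sA (Edge⇒Spans eB))) ]′ (Edge-∪⁻ e))
    fromB : ∀ {u v} → P₁₂ B u v → P₁₂ (A ∪ B) u v ⊎ PairOf p u v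
    fromB {u} {v} PB with u<v , sB , ¬eB ← P₁₂⁻ PB with pairOf? p u v
    ... | yes in-p = inj₂ in-p
    ... | no ∉p = inj₁ (P₁₂⁺ u<v (Spans-mono (q⊆p∪q A B) sB) λ e →
      [ (λ eA → ∉p (inPair ≤-refl (s≤s z≤n) u<v (Edge⇒Spans eA) sB)) , ¬eB ]′ (Edge-∪⁻ e))
    fromBoth : ∀ {u v} → P₁₂ A u v → P₁₂ B u v → P₁₂ (A ∪ B) u v × PairOf p u v
    fromBoth PA PB with u<v , sA , ¬eA ← P₁₂⁻ PA | _ , sB , _ ← P₁₂⁻ PB =
      ⊥-elim (¬eA (pair⇒Edge (inPair (s≤s z≤n) ≤-refl u<v sA sB)))

  Closed : Subset m → Set
  Closed A = ∀ {X Y} → X ∈ A → 2 ≤ ∣ E X ∩ E Y ∣ → Y ∈ A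

  -- No pair is counted twice: edges of `A` and `B` through the same pair would meet in two
  -- vertices, so closedness would put the edge of `B` into `A`.
  P₁-∪ : ∀ {A B} → Closed A → Disjoint A B →
         P1card (2 + d) E (A ∪ B) ≡ P1card (2 + d) E A + P1card (2 + d) E B
  P₁-∪ {A} {B} closed dj = begin
    P1card (2 + d) E (A ∪ B)                 ≡⟨ +-identityʳ _ ⟨
    P1card (2 + d) E (A ∪ B) + 0             ≡⟨ cong₂ _+_ (P₁card≡♯ (A ∪ B)) (sym (♯-pairOf-∅ {n})) ⟩
    ♯ (P₁? (A ∪ B)) + ♯ (pairOf? (∅ {n}))          ≡⟨ ≤-antisym
      (♯-modular (P₁? (A ∪ B)) (pairOf? (∅ {n})) (P₁? A) (P₁? B) split ∅-elim λ _ → ∅-elim)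
      (♯-modular (P₁? A) (P₁? B) (P₁? (A ∪ B)) (pairOf? (∅ {n})) (inj₁ ∘ widen (p⊆p∪q B)) (inj₁ ∘ widen (q⊆p∪q A B)) both) ⟩
    ♯ (P₁? A) + ♯ (P₁? B)                    ≡⟨ cong₂ _+_ (P₁card≡♯ A) (P₁card≡♯ B) ⟨
    P1card (2 + d) E A + P1card (2 + d) E B  ∎
    where
    open ≡-Reasoning
    widen : ∀ {F F′ x y} → F ⊆ F′ → P₁ F x y → P₁ F′ x y
    widen F⊆F′ P with x<y , X , X∈F , xy ← P₁⁻ P = P₁⁺ x<y (X , F⊆F′ X∈F , xy)
    split : ∀ {x y} → P₁ (A ∪ B) x y → P₁ A x y ⊎ P₁ B x y
    split P with x<y , e ← P₁⁻ P = ⊎-map (P₁⁺ x<y) (P₁⁺ x<y) (Edge-∪⁻ e)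
    both : ∀ {x y} → P₁ A x y → P₁ B x y → P₁ (A ∪ B) x y × PairOf ∅ x y
    both PA PB with x<y , X , X∈A , x∈X , y∈X ← P₁⁻ PA | _ , Y , Y∈B , x∈Y , y∈Y ← P₁⁻ PB =
      ⊥-elim (dj (closed X∈A (x≢y⇒2≤∣p∣ (toℕ<⇒≢ x<y) (x∈p∩q⁺ (x∈X , x∈Y)) (x∈p∩q⁺ (y∈X , y∈Y)))) Y∈B)

  -- Attaching one edge to a tight set along two vertices.

  module Attach {S X Y} (tS : Tight S) (S≤k : ∣ S ∣ ≤ k) (X∈S : X ∈ S) (Y∉S : Y ∉ S) (XY : 2 ≤ ∣ E X ∩ E Y ∣) where

    private
      dj : Disjoint S ⁅ Y ⁆
      dj = disjoint-⁅⁆ Y∉S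

      EX∩EY⊆ : E X ∩ E Y ⊆ V E S ∩ V E ⁅ Y ⁆
      EX∩EY⊆ = ∩-mono (∈V⁺ E X∈S) (V-⁅⁆⁺ E)

      share2 : 2 ≤ ∣ V E S ∩ V E ⁅ Y ⁆ ∣
      share2 = ≤-trans XY (p⊆q⇒∣p∣≤∣q∣ EX∩EY⊆)

      ¬more : ¬ 3 ≤ ∣ V E S ∩ V E ⁅ Y ⁆ ∣
      ¬more = ¬share3 dj tS (tight-⁅⁆ Y) (nonempty⇒1≤∣p∣ (X , X∈S)) (proj₁ (piece-⁅⁆ Y))
        (≤-trans (≤-reflexive (∣∪⁅⁆∣ Y∉S)) (s≤s S≤k))

      -- Three vertices common to `S` and `Y` are excluded and `E X ∩ E Y` provides two, so there
      -- are no others.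
      V∩EY⊆ : ∀ {x} → x ∈ V E S → x ∈ E Y → x ∈ E X ∩ E Y
      V∩EY⊆ x∈S x∈Y = p⊆q∧∣q∣≤∣p∣⇒q⊆p EX∩EY⊆ (≤-trans (m<1+n⇒m≤n (≰⇒> ¬more)) XY) (x∈p∩q⁺ (x∈S , V-⁅⁆⁺ E x∈Y))

      ∣EX∩EY∣≡2 : ∣ E X ∩ E Y ∣ ≡ 2
      ∣EX∩EY∣≡2 = ≤-antisym (≤-trans (p⊆q⇒∣p∣≤∣q∣ EX∩EY⊆) (m<1+n⇒m≤n (≰⇒> ¬more))) XY

    tight : Tight (S ∪ ⁅ Y ⁆)
    tight = tight-∪ dj tS (tight-⁅⁆ Y) share2

    -- The enlarged set is tight, so it cannot have the size `suc k`; the induction may therefore go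
    -- on.
    small : ∣ S ∪ ⁅ Y ⁆ ∣ ≤ k
    small with m≤n⇒m<n∨m≡n (≤-trans (≤-reflexive (∣∪⁅⁆∣ Y∉S)) (s≤s S≤k))
    ... | inj₁ (s≤s ≤k) = ≤k
    ... | inj₂ ≡k = ⊥-elim (¬tight ≡k tight)

    -- Inclusion-exclusion: a pair of `E Y` lying in an edge of `S` is inside `E X ∩ E Y`, and this
    -- one pair is the `1`.
    count₁ : P1card (2 + d) E (S ∪ ⁅ Y ⁆) + 1 ≡ P1card (2 + d) E S + (2 + d) C 2
    count₁ = begin
      P1card (2 + d) E (S ∪ ⁅ Y ⁆) + 1
        ≡⟨ cong₂ _+_ (P₁card≡♯ (S ∪ ⁅ Y ⁆)) (sym (trans (♯-pairOf (E X ∩ E Y)) (cong (_C 2) ∣EX∩EY∣≡2))) ⟩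
      ♯ (P₁? (S ∪ ⁅ Y ⁆)) + ♯ (pairOf? (E X ∩ E Y))   ≡⟨ ≤-antisym
        (♯-modular (P₁? (S ∪ ⁅ Y ⁆)) (pairOf? (E X ∩ E Y)) (P₁? S) (pairOf? (E Y))
          split (inj₁ ∘ old) (λ _ p → old p , new p))
        (♯-modular (P₁? S) (pairOf? (E Y)) (P₁? (S ∪ ⁅ Y ⁆)) (pairOf? (E X ∩ E Y))
          (inj₁ ∘ fromS) (inj₁ ∘ fromY) (λ PS PY → fromS PS , both PS PY)) ⟩
      ♯ (P₁? S) + ♯ (pairOf? (E Y))
        ≡⟨ cong₂ _+_ (sym (P₁card≡♯ S)) (trans (♯-pairOf (E Y)) (cong (_C 2) (uniform Y))) ⟩
      P1card (2 + d) E S + (2 + d) C 2                ∎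
      where
      open ≡-Reasoning
      split : ∀ {x y} → P₁ (S ∪ ⁅ Y ⁆) x y → P₁ S x y ⊎ PairOf (E Y) x y
      split P with x<y , e ← P₁⁻ P with Edge-∪⁻ e
      ... | inj₁ eS = inj₁ (P₁⁺ x<y eS)
      ... | inj₂ (Z , Z∈ , x∈Z , y∈Z) with refl ← x∈⁅y⁆⇒x≡y Y Z∈ = inj₂ (x<y , x∈Z , y∈Z)
      old : ∀ {x y} → PairOf (E X ∩ E Y) x y → P₁ S x y
      old (x<y , x∈ , y∈) = P₁⁺ x<y (X , X∈S , p∩q⊆p (E X) (E Y) x∈ , p∩q⊆p (E X) (E Y) y∈)
      new : ∀ {x y} → PairOf (E X ∩ E Y) x y → PairOf (E Y) x y
      new (x<y , x∈ , y∈) = x<y , p∩q⊆q (E X) (E Y) x∈ , p∩q⊆q (E X) (E Y) y∈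
      fromS : ∀ {x y} → P₁ S x y → P₁ (S ∪ ⁅ Y ⁆) x y
      fromS P with x<y , Z , Z∈S , xy ← P₁⁻ P = P₁⁺ x<y (Z , p⊆p∪q ⁅ Y ⁆ Z∈S , xy)
      fromY : ∀ {x y} → PairOf (E Y) x y → P₁ (S ∪ ⁅ Y ⁆) x y
      fromY (x<y , xy) = P₁⁺ x<y (Y , q⊆p∪q S ⁅ Y ⁆ (x∈⁅x⁆ Y) , xy)
      both : ∀ {x y} → P₁ S x y → PairOf (E Y) x y → PairOf (E X ∩ E Y) x y
      both P (x<y , x∈Y , y∈Y) with _ , Z , Z∈S , x∈Z , y∈Z ← P₁⁻ P =
        x<y , V∩EY⊆ (∈V⁺ E Z∈S x∈Z) x∈Y , V∩EY⊆ (∈V⁺ E Z∈S y∈Z) y∈Y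

    -- The `d ^ 2` new pairs join `E X` without `E Y` to `E Y` without `E X`. They are spanned by
    -- the two edges `X` and `Y`, and each contains a vertex not in `V E S`, so they are new and lie
    -- in no edge. No old pair is lost: inside `E Y` it would be inside `E X`, an edge of `S`.
    count₁₂ : P12card (2 + d) E S + d ^ 2 ≤ P12card (2 + d) E (S ∪ ⁅ Y ⁆)
    count₁₂ = begin
      P12card (2 + d) E S + d ^ 2
        ≡⟨ cong₂ _+_ (P₁₂card≡♯ S) (sym (trans (♯-across U W UW) (cong₂ _*_ ∣U∣≡d (trans ∣W∣≡d (sym (*-identityʳ d)))))) ⟩
      ♯ (P₁₂? S) + ♯ (across? U W)
        ≤⟨ ♯-modular (P₁₂? S) (across? U W) (P₁₂? (S ∪ ⁅ Y ⁆)) (pairOf? (∅ {n}))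
          (inj₁ ∘ fromS) (inj₁ ∘ fromUW) (λ PS PUW → ⊥-elim (apart PS PUW)) ⟩
      ♯ (P₁₂? (S ∪ ⁅ Y ⁆)) + ♯ (pairOf? (∅ {n}))         ≡⟨ cong₂ _+_ (sym (P₁₂card≡♯ (S ∪ ⁅ Y ⁆))) (♯-pairOf-∅ {n}) ⟩
      P12card (2 + d) E (S ∪ ⁅ Y ⁆) + 0            ≡⟨ +-identityʳ _ ⟩
      P12card (2 + d) E (S ∪ ⁅ Y ⁆)                ∎
      where
      open ≤-Reasoning
      U = E X ∩ ∁ (E Y)
      W = E Y ∩ ∁ (E X)
      U⁻ : ∀ {x} → x ∈ U → x ∈ E X × x ∉ E Y
      U⁻ x∈ = let x∈X , x∈∁ = x∈p∩q⁻ (E X) _ x∈ in x∈X , x∈∁p⇒x∉p x∈∁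
      W⁻ : ∀ {x} → x ∈ W → x ∈ E Y × x ∉ E X
      W⁻ x∈ = let x∈Y , x∈∁ = x∈p∩q⁻ (E Y) _ x∈ in x∈Y , x∈∁p⇒x∉p x∈∁
      UW : Disjoint U W
      UW x∈U x∈W = proj₂ (U⁻ x∈U) (proj₁ (W⁻ x∈W))
      ∣U∣≡d : ∣ U ∣ ≡ d
      ∣U∣≡d = +-cancelˡ-≡ 2 _ _ (trans (cong (_+ ∣ U ∣) (sym ∣EX∩EY∣≡2)) (trans (∣p∩q∣+∣p∩∁q∣≡∣p∣ (E X) (E Y)) (uniform X)))
      ∣W∣≡d : ∣ W ∣ ≡ d
      ∣W∣≡d = +-cancelˡ-≡ 2 _ _ (trans (cong (_+ ∣ W ∣) (sym (trans (cong ∣_∣ (∩-comm (E Y) (E X))) ∣EX∩EY∣≡2))) (trans (∣p∩q∣+∣p∩∁q∣≡∣p∣ (E Y) (E X)) (uniform Y)))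
      W∉V : ∀ {x} → x ∈ W → x ∉ V E S
      W∉V x∈W x∈S = proj₂ (W⁻ x∈W) (p∩q⊆p (E X) (E Y) (V∩EY⊆ x∈S (proj₁ (W⁻ x∈W))))
      X≢Y : X ∉ ⁅ Y ⁆
      X≢Y X∈ = Y∉S (subst (_∈ S) (x∈⁅y⁆⇒x≡y Y X∈) X∈S)
      XYspan : ∀ {x y} → x ∈ E X ∪ E Y → y ∈ E X ∪ E Y → Spans 2 (S ∪ ⁅ Y ⁆) x y
      XYspan x∈ y∈ = ⁅ X ⁆ ∪ ⁅ Y ⁆ ,
        ∪-lub (⁅x⁆⊆ (p⊆p∪q ⁅ Y ⁆ X∈S)) (q⊆p∪q S ⁅ Y ⁆) ,
        x≢y⇒∣⁅x⁆∪⁅y⁆∣≡2 (x∉⁅y⁆⇒x≢y X≢Y) ,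
        tight-∪ (λ Z∈X Z∈Y → X≢Y (subst (_∈ ⁅ Y ⁆) (x∈⁅y⁆⇒x≡y X Z∈X) Z∈Y)) (tight-⁅⁆ X) (tight-⁅⁆ Y)
          (≤-trans XY (p⊆q⇒∣p∣≤∣q∣ (∩-mono (V-⁅⁆⁺ E) (V-⁅⁆⁺ E)))) ,
        EX∪EY⊆ x∈ , EX∪EY⊆ y∈
        where
        EX∪EY⊆ : E X ∪ E Y ⊆ V E (⁅ X ⁆ ∪ ⁅ Y ⁆)
        EX∪EY⊆ = ∪-lub (∈V⁺ E (p⊆p∪q ⁅ Y ⁆ (x∈⁅x⁆ X))) (∈V⁺ E (q⊆p∪q ⁅ X ⁆ ⁅ Y ⁆ (x∈⁅x⁆ Y)))
      ¬edge : ∀ {x y} → x ∈ U → y ∈ W → ¬ Edge (S ∪ ⁅ Y ⁆) x y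
      ¬edge x∈U y∈W e with Edge-∪⁻ e
      ... | inj₁ (Z , Z∈S , _ , y∈Z) = W∉V y∈W (∈V⁺ E Z∈S y∈Z)
      ... | inj₂ (Z , Z∈ , x∈Z , _) with refl ← x∈⁅y⁆⇒x≡y Y Z∈ = proj₂ (U⁻ x∈U) x∈Z
      fromS : ∀ {x y} → P₁₂ S x y → P₁₂ (S ∪ ⁅ Y ⁆) x y
      fromS P with x<y , s , ¬e ← P₁₂⁻ P = P₁₂⁺ x<y (Spans-mono (p⊆p∪q ⁅ Y ⁆) s) λ e → [ ¬e , fromY ]′ (Edge-∪⁻ e)
        where
        fromY : Edge ⁅ Y ⁆ _ _ → ⊥
        fromY (Z , Z∈ , x∈Z , y∈Z) with refl ← x∈⁅y⁆⇒x≡y Y Z∈ | _ , s , ¬e ← P₁₂⁻ P =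
          let x∈S , y∈S = Spans⇒∈V s
          in ¬e (X , X∈S , p∩q⊆p (E X) (E Y) (V∩EY⊆ x∈S x∈Z) , p∩q⊆p (E X) (E Y) (V∩EY⊆ y∈S y∈Z))
      fromUW : ∀ {x y} → Across U W x y → P₁₂ (S ∪ ⁅ Y ⁆) x y
      fromUW (x<y , inj₁ (x∈U , y∈W)) = P₁₂⁺ x<y
        (XYspan (p⊆p∪q (E Y) (proj₁ (U⁻ x∈U))) (q⊆p∪q (E X) (E Y) (proj₁ (W⁻ y∈W)))) (¬edge x∈U y∈W)
      fromUW (x<y , inj₂ (x∈W , y∈U)) = P₁₂⁺ x<y
        (XYspan (q⊆p∪q (E X) (E Y) (proj₁ (W⁻ x∈W))) (p⊆p∪q (E Y) (proj₁ (U⁻ y∈U))))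
        (λ { (Z , Z∈ , x∈Z , y∈Z) → ¬edge y∈U x∈W (Z , Z∈ , y∈Z , x∈Z) })
      apart : ∀ {x y} → P₁₂ S x y → Across U W x y → ⊥
      apart P (_ , uw) with _ , s , _ ← P₁₂⁻ P with uw
      ... | inj₁ (_ , y∈W) = W∉V y∈W (proj₂ (Spans⇒∈V s))
      ... | inj₂ (x∈W , _) = W∉V x∈W (proj₁ (Spans⇒∈V s))

  -- The counts for a single cluster.

  c : ℕ
  c = (2 + d) C 2

  -- Makes the truncated difference `∣ T ∣ * c ∸ ∣ T ∣` a genuine subtraction.
  1≤c : 1 ≤ c
  1≤c = begin
    1                          ≤⟨ s≤s z≤n ⟩
    suc d                      ≡⟨ nC1≡n (suc d) ⟨
    suc d C 1                  ≤⟨ m≤m+n (suc d C 1) (suc d C 2) ⟩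
    suc d C 1 + suc d C 2      ≡⟨ nCk+nC[k+1]≡[n+1]C[k+1] (suc d) 1 ⟩
    c                          ∎
    where open ≤-Reasoning

  P₁-⁅⁆ : ∀ X → P1card (2 + d) E ⁅ X ⁆ ≡ c
  P₁-⁅⁆ X = begin
    P1card (2 + d) E ⁅ X ⁆  ≡⟨ P₁card≡♯ ⁅ X ⁆ ⟩
    ♯ (P₁? ⁅ X ⁆)           ≡⟨ sum-cong-≗ (λ x → sum-cong-≗ λ y → ind-cong (P₁? ⁅ X ⁆ x y) (pairOf? (E X) x y) to from) ⟩
    ♯ (pairOf? (E X))       ≡⟨ trans (♯-pairOf (E X)) (cong (_C 2) (uniform X)) ⟩
    c                       ∎
    where
    open ≡-Reasoning
    to : ∀ {x y} → P₁ ⁅ X ⁆ x y → PairOf (E X) x y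
    to P with x<y , Y , Y∈ , xy ← P₁⁻ P with refl ← x∈⁅y⁆⇒x≡y X Y∈ = x<y , xy
    from : ∀ {x y} → PairOf (E X) x y → P₁ ⁅ X ⁆ x y
    from (x<y , xy) = P₁⁺ x<y (X , x∈⁅x⁆ X , xy)

  attachable : ∀ {T S} → OneCluster E T → S ⊆ T → Nonempty S → ¬ T ⊆ S →
               ∃ λ X → ∃ λ Y → X ∈ S × Y ∈ T × Y ∉ S × 2 ≤ ∣ E X ∩ E Y ∣
  attachable (_ , conn , _) S⊆T (X , X∈S) T⊈S with Y , Y∈T , Y∉S ← ¬p⊆q⇒∃ T⊈S =
    crossing E (conn X Y (S⊆T X∈S) Y∈T) X∈S Y∉S

  cluster-expandable : ∀ {T} → OneCluster E T → Expandable T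
  cluster-expandable cl S⊆T ne T⊈S with X , Y , X∈S , Y∈T , Y∉S , XY ← attachable cl S⊆T ne T⊈S =
    ⁅ Y ⁆ , ⁅x⁆⊆ Y∈T , disjoint-⁅⁆ Y∉S , piece-⁅⁆ Y ,
    ≤-trans XY (p⊆q⇒∣p∣≤∣q∣ (∩-mono (∈V⁺ E X∈S) (V-⁅⁆⁺ E)))

  -- `Attach` is iterated from a single edge. Subtracted terms are moved to the other side, so that
  -- each new edge merely adds `c` or `d ^ 2`.
  cluster-counts : ∀ {T} → OneCluster E T →
    P1card (2 + d) E T + ∣ T ∣ ≡ ∣ T ∣ * c + 1 × ∣ T ∣ * d ^ 2 ≤ P12card (2 + d) E T + d ^ 2
  cluster-counts {T} cl@((X₀ , X₀∈T) , _) = let _ , _ , _ , counts = grow Inv extend (⁅x⁆⊆ X₀∈T) start in counts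
    where
    Inv : Subset m → Set
    Inv S = Nonempty S × Tight S × ∣ S ∣ ≤ k ×
      P1card (2 + d) E S + ∣ S ∣ ≡ ∣ S ∣ * c + 1 × ∣ S ∣ * d ^ 2 ≤ P12card (2 + d) E S + d ^ 2
    start : Inv ⁅ X₀ ⁆
    start = (X₀ , x∈⁅x⁆ X₀) , tight-⁅⁆ X₀ ,
      ≤-trans (≤-reflexive (∣⁅x⁆∣≡1 X₀)) (≤-trans (s≤s z≤n) 2≤k) ,
      subst (λ t → P1card (2 + d) E ⁅ X₀ ⁆ + t ≡ t * c + 1) (sym (∣⁅x⁆∣≡1 X₀))
        (cong (_+ 1) (trans (P₁-⁅⁆ X₀) (sym (*-identityˡ c)))) ,
      subst (λ t → t * d ^ 2 ≤ P12card (2 + d) E ⁅ X₀ ⁆ + d ^ 2) (sym (∣⁅x⁆∣≡1 X₀))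
        (≤-trans (≤-reflexive (*-identityˡ (d ^ 2))) (m≤n+m (d ^ 2) _))
    extend : ∀ {S} → S ⊆ T → ¬ T ⊆ S → Inv S → ∃ λ S′ → S′ ⊆ T × ∣ S ∣ < ∣ S′ ∣ × Inv S′
    extend {S} S⊆T T⊈S (ne , tS , S≤k , eq , le) with X , Y , X∈S , Y∈T , Y∉S , XY ← attachable cl S⊆T ne T⊈S =
      S ∪ ⁅ Y ⁆ , ∪-lub S⊆T (⁅x⁆⊆ Y∈T) , ≤-reflexive (sym (∣∪⁅⁆∣ Y∉S)) ,
      (X , p⊆p∪q ⁅ Y ⁆ X∈S) , tight , small , eq′ , le′
      where
      open Attach tS S≤k X∈S Y∉S XY
      p = P1card (2 + d) E S
      p′ = P1card (2 + d) E (S ∪ ⁅ Y ⁆)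
      eq′ : p′ + ∣ S ∪ ⁅ Y ⁆ ∣ ≡ ∣ S ∪ ⁅ Y ⁆ ∣ * c + 1
      eq′ = subst (λ t → p′ + t ≡ t * c + 1) (sym (∣∪⁅⁆∣ Y∉S)) (begin
        p′ + suc ∣ S ∣          ≡⟨ +-assoc p′ 1 ∣ S ∣ ⟨
        (p′ + 1) + ∣ S ∣        ≡⟨ cong (_+ ∣ S ∣) (trans count₁ (+-comm p c)) ⟩
        (c + p) + ∣ S ∣         ≡⟨ +-assoc c p ∣ S ∣ ⟩
        c + (p + ∣ S ∣)         ≡⟨ cong (c +_) eq ⟩
        c + (∣ S ∣ * c + 1)     ≡⟨ +-assoc c (∣ S ∣ * c) 1 ⟨
        suc ∣ S ∣ * c + 1       ∎)
        where open ≡-Reasoning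
      le′ : ∣ S ∪ ⁅ Y ⁆ ∣ * d ^ 2 ≤ P12card (2 + d) E (S ∪ ⁅ Y ⁆) + d ^ 2
      le′ = subst (λ t → t * d ^ 2 ≤ P12card (2 + d) E (S ∪ ⁅ Y ⁆) + d ^ 2) (sym (∣∪⁅⁆∣ Y∉S))
        (≤-trans (+-monoʳ-≤ (d ^ 2) (≤-trans le count₁₂)) (≤-reflexive (+-comm (d ^ 2) _)))

  -- The invariant kept by the merging process.

  edges-meet : ∀ X → 2 ≤ ∣ E X ∩ E X ∣
  edges-meet X = ≤-trans (s≤s (s≤s z≤n)) (≤-reflexive (sym (trans (cong ∣_∣ (∩-idem (E X))) (uniform X))))

  -- An edge meets itself in `2 + d` vertices, so a common edge lets each cluster absorb the other.
  clusters-meet⇒≡ : ∀ {T T′ X} → OneCluster E T → OneCluster E T′ → X ∈ T → X ∈ T′ → T ≡ T′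
  clusters-meet⇒≡ {X = X} cl cl′ X∈T X∈T′ = ⊆-antisym
    (cluster-absorbs E cl′ (proj₁ (proj₂ cl)) X∈T′ X∈T (edges-meet X))
    (cluster-absorbs E cl (proj₁ (proj₂ cl′)) X∈T X∈T′ (edges-meet X))

  value₁ value₂ : Subset m → ℕ
  value₁ T = ∣ T ∣ * c ∸ ∣ T ∣ + 1
  value₂ T = (∣ T ∣ ∸ 1) * d ^ 2

  -- Everything a merge must preserve, with `Ts` the clusters making up `A`. The field `count₁₂` is
  -- the desired lower bound with the number of clusters moved to the right.
  record Part (A : Subset m) (Ts : List (Subset m)) : Set where
    field
      expandable : Expandable A
      closed     : Closed A
      unique     : Unique Ts
      clusters   : ∀ {T} → T ∈ᴸ Ts → OneCluster E T × T ⊆ A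
      cover      : ∀ {X} → X ∈ A → ∃ λ T → T ∈ᴸ Ts × X ∈ T
      count₁     : P1card (2 + d) E A ≡ sum (map value₁ Ts)
      count₁₂    : 1 + sum (map value₂ Ts) ≤ P12card (2 + d) E A + length Ts

  open Part

  cluster-part : ∀ {T} → OneCluster E T → Part T (T ∷ [])
  cluster-part {T} cl = record
    { expandable = cluster-expandable cl
    ; closed     = cluster-closed E cl
    ; unique     = [] ∷ []
    ; clusters   = λ { (here refl) → cl , id }
    ; cover      = λ X∈T → T , here refl , X∈T
    ; count₁     = +-cancelʳ-≡ ∣ T ∣ _ _ (trans (proj₁ (cluster-counts cl)) (sym (begin
        (∣ T ∣ * c ∸ ∣ T ∣ + 1 + 0) + ∣ T ∣
          ≡⟨ solve 2 (λ a t → (a :+ con 1 :+ con 0) :+ t := (a :+ t) :+ con 1) refl (∣ T ∣ * c ∸ ∣ T ∣) ∣ T ∣ ⟩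
        (∣ T ∣ * c ∸ ∣ T ∣ + ∣ T ∣) + 1      ≡⟨ cong (_+ 1) (m∸n+n≡m T≤Tc) ⟩
        ∣ T ∣ * c + 1                        ∎)))
    ; count₁₂    = ≤-trans (s≤s bound) (≤-reflexive (+-comm 1 _))
    }
    where
    open ≡-Reasoning
    open +-*-Solver
    T≤Tc : ∣ T ∣ ≤ ∣ T ∣ * c
    T≤Tc = ≤-trans (≤-reflexive (sym (*-identityʳ ∣ T ∣))) (*-monoʳ-≤ ∣ T ∣ 1≤c)
    bound : (∣ T ∣ ∸ 1) * d ^ 2 + 0 ≤ P12card (2 + d) E T
    bound = ≤-trans (≤-reflexive (trans (+-identityʳ _) (*-distribʳ-∸ (d ^ 2) ∣ T ∣ 1)))
      (m≤n+o⇒m∸n≤o _ _ (≤-trans (proj₂ (cluster-counts cl))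
        (≤-reflexive (trans (+-comm _ (d ^ 2)) (cong (_+ P12card (2 + d) E T) (sym (*-identityˡ (d ^ 2))))))))

  sum-map-++ : (f : Subset m → ℕ) (Ts Us : List (Subset m)) → sum (map f (Ts ++ᴸ Us)) ≡ sum (map f Ts) + sum (map f Us)
  sum-map-++ f Ts Us = trans (cong sum (List.map-++ f Ts Us)) (sum-++ (map f Ts) (map f Us))

  mergeable-expandable : ∀ {A B i j x y} → Expandable A → Expandable B → 1 ≤ i → i ≤ 2 → 1 ≤ j → j ≤ 2 → x ≢ y →
                         Spans i A x y → Spans j B x y → Expandable (A ∪ B)
  mergeable-expandable expA expB 1≤i i≤2 1≤j j≤2 x≢y (a , a⊆A , refl , ta , x∈a , y∈a) (b , b⊆B , refl , tb , x∈b , y∈b) =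
    expandable-∪ expA expB a⊆A b⊆B (1≤i , i≤2 , ta) (1≤j , j≤2 , tb)
      (x≢y⇒2≤∣p∣ x≢y (x∈p∩q⁺ (x∈a , x∈b)) (x∈p∩q⁺ (y∈a , y∈b)))

  merge : ∀ {A B Ts Us} → Part A Ts → Part B Us → Disjoint A B → Mergeable (2 + d) E A B → Part (A ∪ B) (Ts ++ᴸ Us)
  merge {A} {B} {Ts} {Us} pA pB dj (x , y , x≢y , kinds) = record
    { expandable = proj₁ (glue kinds)
    ; closed     = λ X∈ XY → [ (λ X∈A → p⊆p∪q B (closed pA X∈A XY)) , (λ X∈B → q⊆p∪q A B (closed pB X∈B XY)) ]′ (x∈p∪q⁻ A B X∈)
    ; unique     = Unique-++⁺ (unique pA) (unique pB) λ (T∈Ts , T∈Us) →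
        let (X , X∈T) , _ = proj₁ (clusters pA T∈Ts)
        in dj (proj₂ (clusters pA T∈Ts) X∈T) (proj₂ (clusters pB T∈Us) X∈T)
    ; clusters   = λ T∈ → [ (λ T∈Ts → let cl , T⊆A = clusters pA T∈Ts in cl , λ {_} X∈T → p⊆p∪q B (T⊆A X∈T))
                          , (λ T∈Us → let cl , T⊆B = clusters pB T∈Us in cl , λ {_} X∈T → q⊆p∪q A B (T⊆B X∈T)) ]′ (∈-++⁻ Ts T∈)
    ; cover      = λ X∈ → [ (λ X∈A → let T , T∈Ts , X∈T = cover pA X∈A in T , ∈-++⁺ˡ T∈Ts , X∈T)
                          , (λ X∈B → let T , T∈Us , X∈T = cover pB X∈B in T , ∈-++⁺ʳ Ts T∈Us , X∈T) ]′ (x∈p∪q⁻ A B X∈)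
    ; count₁     = trans (P₁-∪ (closed pA) dj) (trans (cong₂ _+_ (count₁ pA) (count₁ pB)) (sym (sum-map-++ value₁ Ts Us)))
    -- The two bounds each bring a `1` on the left; one of them pays for the pair that the merge may
    -- lose, the other remains.
    ; count₁₂    = +-cancelʳ-≤ 1 _ _ (begin
        1 + sum (map value₂ (Ts ++ᴸ Us)) + 1              ≡⟨ cong (λ s → 1 + s + 1) (sum-map-++ value₂ Ts Us) ⟩
        1 + (vA + vB) + 1
          ≡⟨ solve 2 (λ a b → con 1 :+ (a :+ b) :+ con 1 := (con 1 :+ a) :+ (con 1 :+ b)) refl vA vB ⟩
        (1 + vA) + (1 + vB)                               ≤⟨ +-mono-≤ (count₁₂ pA) (count₁₂ pB) ⟩
        (qA + length Ts) + (qB + length Us)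
          ≡⟨ solve 4 (λ p t q u → (p :+ t) :+ (q :+ u) := (p :+ q) :+ (t :+ u)) refl qA (length Ts) qB (length Us) ⟩
        (qA + qB) + (length Ts + length Us)
          ≤⟨ +-mono-≤ (proj₂ (glue kinds)) (≤-reflexive (sym (List.length-++ Ts))) ⟩
        (qAB + 1) + length (Ts ++ᴸ Us)
          ≡⟨ solve 2 (λ p t → (p :+ con 1) :+ t := (p :+ t) :+ con 1) refl qAB (length (Ts ++ᴸ Us)) ⟩
        qAB + length (Ts ++ᴸ Us) + 1                      ∎)
    }
    where
    open ≤-Reasoning
    open +-*-Solver
    vA = sum (map value₂ Ts)
    vB = sum (map value₂ Us)
    qA = P12card (2 + d) E A
    qB = P12card (2 + d) E B
    qAB = P12card (2 + d) E (A ∪ B)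
    expA = expandable pA
    expB = expandable pB
    spans₁ : ∀ {F} → InC (2 + d) E F x y 1 → Spans 1 F x y
    spans₁ = InC⇒Spans ≤-refl (≤-trans (s≤s z≤n) 2≤k)
    spans₂ : ∀ {F} → InC (2 + d) E F x y 2 → Spans 2 F x y
    spans₂ = InC⇒Spans (s≤s z≤n) 2≤k
    glue : InC (2 + d) E A x y 1 × InC (2 + d) E B x y 2 ⊎ InC (2 + d) E A x y 2 × InC (2 + d) E B x y 1 →
           Expandable (A ∪ B) × qA + qB ≤ qAB + 1
    glue (inj₁ (A₁ , B₂)) =
      mergeable-expandable expA expB (s≤s z≤n) (s≤s z≤n) (s≤s z≤n) ≤-refl x≢y (spans₁ A₁) (spans₂ B₂) ,
      P₁₂-∪ expA expB dj x≢y (Spans⇒Edge (spans₁ A₁)) (spans₂ B₂)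
    -- `P₁₂-∪` takes the side containing the edge first, so here the roles of `A` and `B` are
    -- exchanged.
    glue (inj₂ (A₂ , B₁)) =
      mergeable-expandable expA expB (s≤s z≤n) ≤-refl (s≤s z≤n) (s≤s z≤n) x≢y (spans₂ A₂) (spans₁ B₁) ,
      subst₂ _≤_ (+-comm qB qA) (cong (λ F → P12card (2 + d) E F + 1) (∪-comm B A))
        (P₁₂-∪ expB expA (λ X∈B X∈A → dj X∈A X∈B) x≢y (Spans⇒Edge (spans₁ B₁)) (spans₂ A₂))

  -- From the clusters through all merges to the final partition.

  Partition : List (Subset m) → Set
  Partition L = All (∃ ∘ Part) L × AllPairs Disjoint L

  clusters-partition : ∀ {L} → Unique L → All (OneCluster E) L → Partition L
  clusters-partition []       []         = [] , []
  clusters-partition {T ∷ _} (T∉ ∷ u) (cl ∷ cls) with parts , djs ← clusters-partition u cls =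
    (_ , cluster-part cl) ∷ parts ,
    All.zipWith (λ (T≢T′ , cl′) {_} X∈T X∈T′ → T≢T′ (clusters-meet⇒≡ cl cl′ X∈T X∈T′)) (T∉ , cls) ∷ djs

  merges-partition : ∀ {L L′} → Merges (2 + d) E L L′ → Partition L → Partition L′
  merges-partition done partition = partition
  merges-partition (more (A , B , rest , L↭ , AB , refl) merges) (parts , djs)
    with (_ , pA) ∷ (_ , pB) ∷ parts′ ← All-resp-↭ L↭ parts
       | (dj ∷ djA) ∷ djB ∷ djs′ ← AllPairs-resp-↭ (setoid _) {R = Disjoint} (λ dj {_} X∈B X∈A → dj X∈A X∈B) (resp₂ _) (↭⇒↭ₛ L↭) djs =
    merges-partition merges
      ( (_ , merge pA pB dj AB) ∷ parts′
      , All.zipWith (λ (dA , dB) {_} X∈ X∈C → [ (λ X∈A → dA X∈A X∈C) , (λ X∈B → dB X∈B X∈C) ]′ (x∈p∪q⁻ A B X∈)) (djA , djB) ∷ djs′)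

  M₂-part : ∀ {M₂ F} → IsM2 (2 + d) E M₂ → F ∈ᴸ M₂ → ∃ (Part F)
  M₂-part (L₁ , (u , isM₁) , merges , _) F∈ =
    All.lookup (proj₁ (merges-partition merges
      (clusters-partition u (All.tabulate λ {T} → proj₁ (isM₁ T))))) F∈

  -- Identifies the clusters collected during the merges with the given list. Both are free of
  -- repetitions, and a cluster inside `F` shares an edge with some collected cluster, hence equals
  -- it.
  part-↭ : ∀ {F Ts Us} → Part F Ts → Unique Us →
           (∀ T → (T ∈ᴸ Us → OneCluster E T × T ⊆ F) × (OneCluster E T × T ⊆ F → T ∈ᴸ Us)) → Ts ↭ Us
  part-↭ {F} {Ts} {Us} pF uUs char = ∼bag⇒↭ (unique∧set⇒bag (unique pF) uUs (mk⇔ (λ T∈ → proj₂ (char _) (clusters pF T∈)) from))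
    where
    from : ∀ {T} → T ∈ᴸ Us → T ∈ᴸ Ts
    from {T} T∈ with cl@((X , X∈T) , _) , T⊆F ← proj₁ (char T) T∈ with T′ , T′∈ , X∈T′ ← cover pF (T⊆F X∈T) =
      subst (_∈ᴸ Ts) (clusters-meet⇒≡ (proj₁ (clusters pF T′∈)) cl X∈T′ X∈T) T′∈

  part-counts : ∀ {F Ts Us} → Part F Ts → Ts ↭ Us →
    P1card (2 + d) E F ≡ sum (map value₁ Us) × 1 + sum (map value₂ Us) ≤ P12card (2 + d) E F + length Us
  part-counts {F} pF Ts↭Us =
    trans (count₁ pF) (sum-↭ (↭-map⁺ value₁ Ts↭Us)) ,
    subst₂ (λ s l → 1 + s ≤ P12card (2 + d) E F + l) (sum-↭ (↭-map⁺ value₂ Ts↭Us)) (↭-length Ts↭Us) (count₁₂ pF)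

-- The lower bound over the integers, and the theorem.

open import Data.Integer using (+_; +≤+) renaming (_≤_ to _≤ℤ_; _+_ to _+ℤ_; _-_ to _-ℤ_; -_ to ℤ-_)
import Data.Integer.Properties as ℤ

-- The bound may be negative, so truncated subtraction would misstate it; the number of clusters is
-- moved back only here, over the integers.
1+v≤q+l⇒1-l+v≤q : ∀ l v q → 1 + v ≤ q + l → ((+ 1) -ℤ (+ l)) +ℤ (+ v) ≤ℤ (+ q)
1+v≤q+l⇒1-l+v≤q l v q le = begin
  ((+ 1) -ℤ (+ l)) +ℤ (+ v)           ≡⟨ ℤ.+-assoc (+ 1) (ℤ- (+ l)) (+ v) ⟩
  (+ 1) +ℤ ((ℤ- (+ l)) +ℤ (+ v))      ≡⟨ cong ((+ 1) +ℤ_) (ℤ.+-comm (ℤ- (+ l)) (+ v)) ⟩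
  (+ 1) +ℤ ((+ v) -ℤ (+ l))           ≡⟨ ℤ.+-assoc (+ 1) (+ v) (ℤ- (+ l)) ⟨
  (+ (1 + v)) -ℤ (+ l)                ≤⟨ ℤ.+-monoˡ-≤ (ℤ- (+ l)) (+≤+ le) ⟩
  (+ (q + l)) -ℤ (+ l)                ≡⟨ ℤ.+-assoc (+ q) (+ l) (ℤ- (+ l)) ⟩
  (+ q) +ℤ ((+ l) -ℤ (+ l))           ≡⟨ cong ((+ q) +ℤ_) (ℤ.+-inverseʳ (+ l)) ⟩
  (+ q) +ℤ (+ 0)                      ≡⟨ ℤ.+-identityʳ (+ q) ⟩
  (+ q)                               ∎
  where open ℤ.≤-Reasoning

theorem3p9 : (r k m n : ℕ) → 3 ≤ r → 3 ≤ k → (E : Fin m → Subset n) → IsRGraph r E → GkFree r k E →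
    (M₂ : List (Subset m)) → IsM2 r E M₂ → (F : Subset m) → F ∈ᴸ M₂ →
    (Ts : List (Subset m)) → Unique Ts → (∀ (T : Subset m) → (T ∈ᴸ Ts → OneCluster E T × T ⊆ F) × (OneCluster E T × T ⊆ F → T ∈ᴸ Ts)) →
    (P1card r E F ≡ sum (map (λ T → ∣ T ∣ * (r C 2) ∸ ∣ T ∣ + 1) Ts))
    × (((+ 1) -ℤ (+ length Ts)) +ℤ (+ sum (map (λ T → (∣ T ∣ ∸ 1) * (r ∸ 2) ^ 2) Ts)) ≤ℤ (+ P12card r E F))
theorem3p9 (suc (suc r)) (suc k) m n (s≤s (s≤s _)) (s≤s 2≤k) E (uniform , _) free M₂ isM₂ F F∈M₂ Ts uTs char =
  -- After matching, `r` is the `d` of `FreeHypergraph` and the forbidden size is `suc k`.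
  let _ , pF = M₂-part isM₂ F∈M₂
      eq , le = part-counts pF (part-↭ pF uTs char)
  in eq , 1+v≤q+l⇒1-l+v≤q (length Ts) _ (P12card (2 + r) E F) le
  where open FreeHypergraph 2≤k E uniform free
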